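{- Let $n\ge 1$ and let $P_n$ be a labeled path on $n$ vertices. Then the chromatic quasisymmetric function $X(P_n;\mathbf{x},q)$ is symmetric if and only if $P_n$ has the natural labeling.
   Context: A labeled graph is a finite simple graph $G=(V,E)$ with vertex set $V=[n]=\{1,\dots,n\}$. A proper coloring is a map $c\colon[n]\to\mathbb{P}=\{1,2,\dots\}$ with $c(i)\neq c(j)$ whenever $ij\in E$. Its ascent set is $\operatorname{Asc}(c)=\{ij\in E : i<j,\ c(i)<c(j)\}$ and $\operatorname{asc}(c)=\#\operatorname{Asc}(c)$. The chromatic quasisymmetric function (CQF) is $X(G;\mathbf{x},q)=\sum_{c}x_{c(1)}x_{c(2)}\cdots x_{c(n)}\,q^{\operatorname{asc}(c)}$, summed over proper colorings $c$; it is a polynomial in $q$ whose coefficients are quasisymmetric functions. It is called symmetric if every coefficient of $q^k$ is a symmetric function. A labeled path $P_n$ is the path graph with vertices $v_1,\dots,v_n$ (edges $v_iv_{i+1}$, $1\le i\le n-1$) where $v_i$ carries label $\sigma_i$ for a permutation $\sigma=\sigma_1\cdots\sigma_n$ of $[n]$ (vertices are identified with their labels). The natural labeling is $\sigma=12\cdots n$ or $\sigma=n\cdots 21$. -}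

module Defs where

open import Data.Nat using (ℕ; zero; suc; _≤_; _<_; _≟_; _<?_)
open import Data.Nat.ListAction using (sum)
open import Data.Nat.Properties using (≮⇒≥; ≰⇒>; <⇒≢; <-≤-trans; 1+n≢n; allUpTo?)
open import Data.Empty using (⊥)
open import Data.Fin as Fin using (Fin; toℕ; opposite)
import Data.Fin.Properties as Fin
open import Data.Fin.Permutation using (Permutation′; _⟨$⟩ʳ_)
open import Data.List using (List; []; _∷_; map; filter; length; upTo; allFin; cartesianProduct; cartesianProductWith)
open import Data.List.Membership.Propositional using (_∈_)
open import Data.List.Membership.Propositional.Properties using (∈-cartesianProductWith⁺; ∈-upTo⁺)
open import Data.List.Relation.Unary.Any using (here)
open import Data.List.Relation.Unary.All using ([])
open import Data.List.Relation.Unary.AllPairs using ([]; _∷_)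
open import Data.List.Relation.Unary.Unique.Propositional using (Unique)
import Data.List.Relation.Unary.Unique.Propositional.Properties as Unique
open import Data.Product using (∃-syntax; _×_; _,_)
open import Data.Sum using (_⊎_; inj₁; inj₂; swap)
open import Data.Vec using (Vec; []; _∷_; lookup; count)
open import Data.Vec.Properties using (∷-injective)
open import Data.Vec.Relation.Unary.All as All using (All; []; _∷_)
open import Function.Bundles using (_↔_; Inverse; Injection)
open import Function.Properties.Inverse using (Inverse⇒Injection)
open import Level using (0ℓ)
open import Relation.Binary using (Rel; Decidable; Symmetric; Irreflexive)
open import Relation.Binary.PropositionalEquality using (_≡_; _≢_; refl; sym; trans; cong; ≢-sym)
open import Relation.Nullary using (Dec; yes; no; contradiction)
open import Relation.Nullary.Decidable using (map′; dec-true; dec-false; _×-dec_; _⊎-dec_; _→-dec_; ¬?)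

-- The vertex set [n] is Fin n, with its usual order.
record LabeledGraph (n : ℕ) : Set₁ where
  field
    Edge   : Rel (Fin n) 0ℓ
    edge?  : Decidable Edge
    symm   : Symmetric Edge
    irrefl : Irreflexive _≡_ Edge

open LabeledGraph public

-- A colouring c : [n] → ℙ is given by its table of values. The colour
-- k ∈ ℙ = {1, 2, …} is represented by k - 1, so that the variables
-- x₁, x₂, … are indexed by ℕ; only the order of the colours matters.
Colouring : ℕ → Set
Colouring n = Vec ℕ n

Proper : ∀ {n} → LabeledGraph n → Colouring n → Set
Proper G c = ∀ i j → Edge G i j → lookup c i ≢ lookup c j

proper? : ∀ {n} (G : LabeledGraph n) (c : Colouring n) → Dec (Proper G c)
proper? G c = Fin.all? λ i → Fin.all? λ j →
  edge? G i j →-dec ¬? (lookup c i ≟ lookup c j)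

-- An edge ij with i < j is listed once, as the pair (i , j).
Asc : ∀ {n} → LabeledGraph n → Colouring n → List (Fin n × Fin n)
Asc {n} G c = filter
  (λ (i , j) → edge? G i j ×-dec (i Fin.<? j) ×-dec (lookup c i <? lookup c j))
  (cartesianProduct (allFin n) (allFin n))

asc : ∀ {n} → LabeledGraph n → Colouring n → ℕ
asc G c = length (Asc G c)

-- A monomial ∏ᵢ xᵢ ^ exponent i in infinitely many variables. Monomials are
-- identified when their exponents agree; the choice of bound is immaterial.
record Monomial : Set where
  field
    exponent : ℕ → ℕ
    bound    : ℕ
    finite   : ∀ i → bound ≤ i → exponent i ≡ 0

open Monomial public

degree : Monomial → ℕ
degree α = sum (map (exponent α) (upTo (bound α)))

-- Formal power series, as functions from monomials to coefficients. The
-- coefficients occurring here are cardinalities, hence natural numbers.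
PowerSeries : Set
PowerSeries = Monomial → ℕ

BoundedDegree : PowerSeries → Set
BoundedDegree f = ∃[ d ] ∀ α → d < degree α → f α ≡ 0

-- f is unchanged by every permutation of the variables. Taking π to be the
-- identity, f is in particular independent of the bounds of monomials.
PermutationInvariant : PowerSeries → Set
PermutationInvariant f = (π : ℕ ↔ ℕ) (α β : Monomial) →
  (∀ i → exponent β i ≡ exponent α (Inverse.to π i)) → f α ≡ f β

IsSymmetricFunction : PowerSeries → Set
IsSymmetricFunction f = BoundedDegree f × PermutationInvariant f

multiplicity : ∀ {n} → ℕ → Colouring n → ℕ
multiplicity i c = count (i ≟_) c

-- x_{c(1)} x_{c(2)} ⋯ x_{c(n)} is the monomial α.
HasMonomial : ∀ {n} → Monomial → Colouring n → Set
HasMonomial α c = ∀ i → multiplicity i c ≡ exponent α i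

multiplicity-here : ∀ {n} x (c : Colouring n) →
  multiplicity x (x ∷ c) ≡ suc (multiplicity x c)
multiplicity-here x c rewrite dec-true (x ≟ x) refl = refl

multiplicity-there : ∀ {n k x} (c : Colouring n) → k ≢ x →
  multiplicity k (x ∷ c) ≡ multiplicity k c
multiplicity-there {k = k} {x} c k≢x rewrite dec-false (k ≟ x) k≢x = refl

multiplicity-tail : ∀ {n k} x (c : Colouring n) →
  multiplicity k (x ∷ c) ≡ 0 → multiplicity k c ≡ 0
multiplicity-tail {k = k} x c z with k ≟ x
... | yes refl = contradiction (trans (sym z) (multiplicity-here x c)) λ ()
... | no k≢x   = trans (sym (multiplicity-there c k≢x)) z

multiplicity-beyond : ∀ {n b k} {c : Colouring n} →
  All (_< b) c → b ≤ k → multiplicity k c ≡ 0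
multiplicity-beyond []                      b≤k = refl
multiplicity-beyond {c = x ∷ c} (x<b ∷ c<b) b≤k =
  trans (multiplicity-there c (≢-sym (<⇒≢ (<-≤-trans x<b b≤k))))
        (multiplicity-beyond c<b b≤k)

coloursBounded : ∀ {n} (α : Monomial) (c : Colouring n) →
  HasMonomial α c → All (_< bound α) c
coloursBounded α c h = go c λ k b≤k → trans (h k) (finite α k b≤k)
  where
  go : ∀ {n} (d : Colouring n) →
    (∀ k → bound α ≤ k → multiplicity k d ≡ 0) → All (_< bound α) d
  go []      z = []
  go (x ∷ d) z = ≰⇒> (λ b≤x → contradiction
                   (trans (sym (z x b≤x)) (multiplicity-here x d)) λ ())
               ∷ go d λ k b≤k → multiplicity-tail x d (z k b≤k)

hasMonomial? : ∀ {n} (α : Monomial) (c : Colouring n) → Dec (HasMonomial α c)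
hasMonomial? α c = map′ to (λ h → coloursBounded α c h , λ {i} _ → h i)
  (All.all? (_<? bound α) c ×-dec
   allUpTo? (λ i → multiplicity i c ≟ exponent α i) (bound α))
  where
  to : All (_< bound α) c ×
       (∀ {i} → i < bound α → multiplicity i c ≡ exponent α i) →
       HasMonomial α c
  to (p , q) i with i <? bound α
  ... | yes i<b = q i<b
  ... | no i≮b  =
    trans (multiplicity-beyond p (≮⇒≥ i≮b)) (sym (finite α i (≮⇒≥ i≮b)))

colourings : (b n : ℕ) → List (Colouring n)
colourings b zero    = [] ∷ []
colourings b (suc n) = cartesianProductWith _∷_ (upTo b) (colourings b n)

∈-colourings : ∀ {b n} {c : Colouring n} → All (_< b) c → c ∈ colourings b n
∈-colourings []       = here refl
∈-colourings (p ∷ ps) = ∈-cartesianProductWith⁺ _∷_ (∈-upTo⁺ p) (∈-colourings ps)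

colourings-unique : ∀ b n → Unique (colourings b n)
colourings-unique b zero    = [] ∷ []
colourings-unique b (suc n) = Unique.cartesianProductWith⁺ _∷_ ∷-injective
  (Unique.upTo⁺ b) (colourings-unique b n)

-- CQF G k is the coefficient of q ^ k in X(G; x, q). Its coefficient at α is
-- the number of proper colourings c with monomial α and asc c = k; by
-- coloursBounded, ∈-colourings and colourings-unique, the list searched
-- contains each such colouring exactly once.
CQF : ∀ {n} → LabeledGraph n → ℕ → PowerSeries
CQF {n} G k α = length (filter
  (λ c → proper? G c ×-dec hasMonomial? α c ×-dec (asc G c ≟ k))
  (colourings (bound α) n))

SymmetricCQF : ∀ {n} → LabeledGraph n → Set
SymmetricCQF G = ∀ k → IsSymmetricFunction (CQF G k)

-- The vertex in position a of the path carries the label σ ⟨$⟩ʳ a.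
PathEdge : ∀ {n} → Permutation′ n → Rel (Fin n) 0ℓ
PathEdge σ x y = ∃[ a ] ∃[ b ] (toℕ b ≡ suc (toℕ a) ×
  ((x ≡ σ ⟨$⟩ʳ a × y ≡ σ ⟨$⟩ʳ b) ⊎ (y ≡ σ ⟨$⟩ʳ a × x ≡ σ ⟨$⟩ʳ b)))

labeledPath : ∀ {n} → Permutation′ n → LabeledGraph n
labeledPath {n} σ = record
  { Edge   = PathEdge σ
  ; edge?  = λ x y → Fin.any? λ a → Fin.any? λ b →
      (toℕ b ≟ suc (toℕ a)) ×-dec
      (((x Fin.≟ (σ ⟨$⟩ʳ a)) ×-dec (y Fin.≟ (σ ⟨$⟩ʳ b))) ⊎-dec
       ((y Fin.≟ (σ ⟨$⟩ʳ a)) ×-dec (x Fin.≟ (σ ⟨$⟩ʳ b))))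
  ; symm   = λ (a , b , b≡1+a , e) → a , b , b≡1+a , swap e
  ; irrefl = λ { refl (a , b , b≡1+a , inj₁ (p , q)) → loop b≡1+a (trans (sym p) q)
               ; refl (a , b , b≡1+a , inj₂ (p , q)) → loop b≡1+a (trans (sym p) q) }
  }
  where
  loop : ∀ {a b : Fin n} → toℕ b ≡ suc (toℕ a) → σ ⟨$⟩ʳ a ≡ σ ⟨$⟩ʳ b → ⊥
  loop b≡1+a e = 1+n≢n (trans (sym b≡1+a)
    (cong toℕ (sym (Injection.injective (Inverse⇒Injection σ) e))))

NaturalLabeling : ∀ {n} → Permutation′ n → Set
NaturalLabeling σ = (∀ i → σ ⟨$⟩ʳ i ≡ i) ⊎ (∀ i → σ ⟨$⟩ʳ i ≡ opposite i)

{-# OPTIONS --safe #-}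
-- Read along the path, a colouring is a word, and its ascents are the steps
-- agreeing with the sign vector of σ, whose entries tell whether the labels
-- increase; the labeling is natural exactly when the signs are constant.
--
-- If they are constant, exchanging the colours a and a + 1 on the maximal
-- {a , a + 1}-coloured runs of odd length is an involution that preserves the
-- number of ascents and exchanges the exponents of x_a and x_{a + 1}.
--
-- If they are not, consider the extreme coefficients in q: they count the words
-- whose steps all agree with the signs, or all with the opposite signs, so we
-- may assume that the last sign is "up". The colour 0 is used at most as often
-- as there are local minima. If some "down" step is not preceded by an "up"
-- step, some other colour can be used more often than that, against symmetry.
-- Otherwise the path splits into ascending runs, and if a colour j occurs once
-- in each of them, then deleting it, raising the smaller colours by one, and
-- starting each run with 0 is an injection between colourings whose monomials
-- differ by a rotation of the variables. It is not surjective, since the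
-- inverse can create an equality across a "down" step.
module Submission where

open import Defs
open import Data.Nat using (ℕ; _≥_)
open import Data.Fin.Permutation using (Permutation′)
open import Function.Bundles using (_⇔_)

open import Data.Bool using (Bool; true; false; not; if_then_else_)
open import Data.Bool.Properties using (not-involutive) renaming (_≟_ to _≟ᵇ_)
open import Data.Fin as Fin using (Fin; zero; suc; toℕ; inject₁; opposite)
import Data.Fin.Properties as Finₚ
open import Data.Fin.Permutation using (_⟨$⟩ʳ_; _⟨$⟩ˡ_; inverseˡ; inverseʳ)
open import Data.List as List using (List; []; _∷_; _++_; length; filter; allFin; upTo)
open import Data.List.Membership.Propositional using (_∈_)
open import Data.List.Membership.Propositional.Properties using (∈-∃++; ∈-++⁺ˡ; ∈-++⁺ʳ; ∈-++⁻; ∈-filter⁺; ∈-filter⁻; ∈-map⁺; ∈-map⁻; ∈-cartesianProduct⁺; ∈-allFin; ∈-upTo⁺)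
open import Data.List.Properties using (length-++-sucʳ; length-map)
import Data.List.Relation.Unary.All as ListAll
open import Data.List.Relation.Unary.AllPairs using ([]; _∷_)
open import Data.List.Relation.Unary.Any using (here; there)
open import Data.List.Relation.Unary.Unique.Propositional using (Unique)
import Data.List.Relation.Unary.Unique.Propositional.Properties as Unique
open import Data.Nat using (zero; suc; _+_; _∸_; _≤_; _<_; z≤n; s≤s; z<s; s<s; s≤s⁻¹; s<s⁻¹; _≟_; _<?_; _≤?_)
open import Data.Nat.ListAction using () renaming (sum to listSum)
open import Data.Nat.Properties
open import Data.Product using (∃-syntax; _×_; _,_; proj₁; proj₂)
open import Data.Sum using (_⊎_; inj₁; inj₂; [_,_]′)
open import Data.Vec as Vec using (Vec; []; _∷_; lookup; tabulate; head; tail)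
open import Data.Vec.Properties using (lookup∘tabulate; tabulate∘lookup; tabulate-cong; ∷-injective; ≡-dec; map-∘; map-cong; map-id; map-replicate; lookup-replicate)
import Data.Vec.Relation.Unary.All as VecAll
open VecAll using ([]; _∷_)
open import Function.Base using (_∘_; id)
open import Function.Bundles using (_↔_; mk⇔; mk↔ₛ′; Inverse; Injection)
open import Function.Construct.Composition using (_↔-∘_)
open import Function.Construct.Symmetry using (↔-sym)
open import Function.Properties.Inverse using (Inverse⇒Injection)
open import Relation.Binary using (tri<; tri≈; tri>)
open import Relation.Binary.PropositionalEquality
open import Relation.Nullary using (Dec; yes; no; does; contradiction; ¬_)
open import Relation.Nullary.Decidable using (_×-dec_; dec-true; dec-false)
open import Relation.Unary using (Decidable)
open import Algebra.Properties.CommutativeMonoid.Sum +-0-commutativeMonoid using (sum; sum-permute; sum-cong-≗)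
open import Algebra.Properties.CommutativeSemigroup +-commutativeSemigroup using (interchange; x∙yz≈y∙xz)
open Inverse using (to; from; strictlyInverseˡ; strictlyInverseʳ)

-- Counting with repetition-free lists, and comparing counts through injections.

∈-++-drop : ∀ {A : Set} {v w : A} (xs : List A) {ys} → v ∈ xs ++ w ∷ ys → v ≢ w → v ∈ xs ++ ys
∈-++-drop xs v∈ v≢w with ∈-++⁻ xs v∈
... | inj₁ v∈xs         = ∈-++⁺ˡ v∈xs
... | inj₂ (here v≡w)   = contradiction v≡w v≢w
... | inj₂ (there v∈ys) = ∈-++⁺ʳ xs v∈ys

-- Pigeonhole: once `f x` is deleted from `ys`, injectivity keeps the images of the tail among what
-- remains. Injectivity is asked only on members of `xs`, since the shift of words used later is
-- injective only on the words being counted.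
length-injection : ∀ {A B : Set} {xs : List A} {ys : List B} (f : A → B) → Unique xs →
  (∀ {x} → x ∈ xs → f x ∈ ys) →
  (∀ {x y} → x ∈ xs → y ∈ xs → f x ≡ f y → x ≡ y) →
  length xs ≤ length ys
length-injection {xs = []}     f u            into inj = z≤n
length-injection {xs = x ∷ xs} f (x∉xs ∷ u) into inj with ∈-∃++ (into (here refl))
... | ys , zs , refl = ≤-trans
  (s≤s (length-injection f u
    (λ v∈xs → ∈-++-drop ys (into (there v∈xs))
      (λ e → ListAll.lookup x∉xs v∈xs (sym (inj (there v∈xs) (here refl) e))))
    (λ p q → inj (there p) (there q))))
  (≤-reflexive (sym (length-++-sucʳ ys (f x) zs)))

-- Certifies that `P` has exactly `N` elements, so that coefficients can be compared by maps between
-- predicates without reference to the lists that define them.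
record Enumeration {A : Set} (P : A → Set) (N : ℕ) : Set where
  field
    elements : List A
    unique   : Unique elements
    size     : length elements ≡ N
    sound    : ∀ {x} → x ∈ elements → P x
    complete : ∀ {x} → P x → x ∈ elements

open Enumeration public

module _ {A B : Set} {P : A → Set} {Q : B → Set} {M N : ℕ} (f : A → B)
         (into : ∀ {x} → P x → Q (f x))
         (injective : ∀ {x y} → P x → P y → f x ≡ f y → x ≡ y)
         (E : Enumeration P M) (F : Enumeration Q N) where

  enumeration-≤ : M ≤ N
  enumeration-≤ = subst₂ _≤_ (size E) (size F) (length-injection f (unique E)
    (λ p → complete F (into (sound E p)))
    (λ p q → injective (sound E p) (sound E q)))

  -- The images still lie in the target list after `w` is deleted from it, which leaves room for one
  -- more element.
  enumeration-< : ∀ {w} → Q w → (∀ {x} → P x → f x ≢ w) → M < N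
  enumeration-< {w} Qw missed with elements F in eq | complete F Qw
  ... | L | w∈ with ∈-∃++ w∈
  ...   | ys , zs , refl = subst₂ _<_ (size E) (trans (sym (cong length eq)) (size F))
    (≤-trans
      (s≤s (length-injection f (unique E)
        (λ p → ∈-++-drop ys (subst (_ ∈_) eq (complete F (into (sound E p)))) (missed (sound E p)))
        (λ p q → injective (sound E p) (sound E q))))
      (≤-reflexive (sym (length-++-sucʳ ys w zs))))

enumeration-size-unique : ∀ {A : Set} {P Q : A → Set} {M N} → (∀ {x} → P x → Q x) → (∀ {x} → Q x → P x) →
  Enumeration P M → Enumeration Q N → M ≡ N
enumeration-size-unique to from E F = ≤-antisym
  (enumeration-≤ id to (λ _ _ e → e) E F)
  (enumeration-≤ id from (λ _ _ e → e) F E)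

enumeration-witness : ∀ {A : Set} {P Q : A → Set} {N x} → Enumeration P N → Enumeration Q N → P x → ∃[ y ] Q y
enumeration-witness E F Px with elements E in e | size E | complete E Px
... | x ∷ xs | sE | _ with elements F in eq | size F
...   | y ∷ ys | _ = y , sound F (subst (y ∈_) (sym eq) (here refl))
...   | []     | s = contradiction (trans sE (sym s)) λ ()

enumeration-empty : ∀ {A : Set} {P : A → Set} {N} → (∀ {x} → ¬ P x) → Enumeration P N → N ≡ 0
enumeration-empty none E with elements E in eq | size E
... | []    | s = sym s
... | x ∷ _ | _ = contradiction (sound E (subst (x ∈_) (sym eq) (here refl))) none

enumeration-cong : ∀ {A : Set} {P Q : A → Set} {N} → (∀ {x} → P x → Q x) → (∀ {x} → Q x → P x) →
  Enumeration P N → Enumeration Q N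
enumeration-cong to from E = record
  { elements = elements E
  ; unique   = unique E
  ; size     = size E
  ; sound    = λ p → to (sound E p)
  ; complete = λ q → complete E (from q)
  }

enumeration-image : ∀ {A B : Set} {P : A → Set} {Q : B → Set} {N} (f : A → B) →
  (∀ {x y} → f x ≡ f y → x ≡ y) →
  (∀ {x} → P x → Q (f x)) → (∀ {y} → Q y → ∃[ x ] (P x × y ≡ f x)) →
  Enumeration P N → Enumeration Q N
enumeration-image {Q = Q} f inj to from E = record
  { elements = List.map f (elements E)
  ; unique   = Unique.map⁺ inj (unique E)
  ; size     = trans (length-map f (elements E)) (size E)
  ; sound    = λ p → let (x , x∈ , e) = ∈-map⁻ f p in subst Q (sym e) (to (sound E x∈))
  ; complete = λ q → let (x , Px , e) = from q in subst (_∈ _) (sym e) (∈-map⁺ f (complete E Px))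
  }

enumeration-filter : ∀ {A : Set} {P : A → Set} (P? : Decidable P) {xs : List A} → Unique xs →
  (∀ {x} → P x → x ∈ xs) → Enumeration P (length (filter P? xs))
enumeration-filter P? {xs} u all = record
  { elements = filter P? xs
  ; unique   = Unique.filter⁺ P? u
  ; size     = refl
  ; sound    = λ p → proj₂ (∈-filter⁻ P? {xs = xs} p)
  ; complete = λ Px → ∈-filter⁺ P? (all Px) Px
  }

-- Words along a path, with each step compared to a sign.

bit : {A : Set} → Dec A → ℕ
bit a? = if does a? then 1 else 0

bit-yes : {A : Set} (a? : Dec A) → A → bit a? ≡ 1
bit-yes a? a rewrite dec-true a? a = refl

bit-no : {A : Set} (a? : Dec A) → ¬ A → bit a? ≡ 0
bit-no a? ¬a rewrite dec-false a? ¬a = refl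

bit-cong : {A B : Set} (a? : Dec A) (b? : Dec B) → (A → B) → (B → A) → bit a? ≡ bit b?
bit-cong (yes a) b? to from = sym (bit-yes b? (to a))
bit-cong (no ¬a) b? to from = sym (bit-no b? (λ b → ¬a (from b)))

δ : ℕ → ℕ → ℕ
δ k x = bit (k ≟ x)

multiplicity-∷ : ∀ {n} k x (c : Colouring n) → multiplicity k (x ∷ c) ≡ δ k x + multiplicity k c
multiplicity-∷ k x c with does (k ≟ x)
... | true  = refl
... | false = refl

Match : Bool → ℕ → ℕ → Set
Match true  p x = p < x
Match false p x = x < p

match? : ∀ s p x → Dec (Match s p x)
match? true  p x = p <? x
match? false p x = x <? p

-- The colour `p` of the vertex before the word is an index, so the relation sits on the steps, each
-- tested together with its sign.
data Along (R : Bool → ℕ → ℕ → Set) : ∀ {k} → ℕ → Vec Bool k → Vec ℕ k → Set where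
  []  : ∀ {p} → Along R p [] []
  _∷_ : ∀ {k p s x} {ε : Vec Bool k} {xs} → R s p x → Along R x ε xs → Along R p (s ∷ ε) (x ∷ xs)

Distinct : ∀ {k} → ℕ → Vec Bool k → Vec ℕ k → Set
Distinct = Along (λ _ → _≢_)

Fits : ∀ {k} → ℕ → Vec Bool k → Vec ℕ k → Set
Fits = Along Match

matches : ∀ {k} → ℕ → Vec Bool k → Vec ℕ k → ℕ
matches p []      []       = 0
matches p (s ∷ ε) (x ∷ xs) = bit (match? s p x) + matches x ε xs

match⇒≢ : ∀ s {p x} → Match s p x → p ≢ x
match⇒≢ true  p<x = <⇒≢ p<x
match⇒≢ false x<p = ≢-sym (<⇒≢ x<p)

fits⇒distinct : ∀ {k p} {ε : Vec Bool k} {xs} → Fits p ε xs → Distinct p ε xs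
fits⇒distinct []                  = []
fits⇒distinct (_∷_ {s = s} m f) = match⇒≢ s m ∷ fits⇒distinct f

distinct-resp : ∀ {k p} {ε ε′ : Vec Bool k} {xs} → Distinct p ε xs → Distinct p ε′ xs
distinct-resp {ε′ = []}    []        = []
distinct-resp {ε′ = _ ∷ _} (p≢x ∷ d) = p≢x ∷ distinct-resp d

matches≤length : ∀ {k} p (ε : Vec Bool k) xs → matches p ε xs ≤ k
matches≤length p []      []       = z≤n
matches≤length p (s ∷ ε) (x ∷ xs) with does (match? s p x)
... | true  = s≤s (matches≤length x ε xs)
... | false = m≤n⇒m≤1+n (matches≤length x ε xs)

fits⇒matches : ∀ {k p} {ε : Vec Bool k} {xs} → Fits p ε xs → matches p ε xs ≡ k
fits⇒matches []                                  = refl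
fits⇒matches (_∷_ {p = p} {s = s} {x = x} m f) = cong₂ _+_ (bit-yes (match? s p x) m) (fits⇒matches f)

matches⇒fits : ∀ {k} p (ε : Vec Bool k) xs → matches p ε xs ≡ k → Fits p ε xs
matches⇒fits p []      []       e = []
matches⇒fits p (s ∷ ε) (x ∷ xs) e with match? s p x
... | yes m = m ∷ matches⇒fits x ε xs (suc-injective e)
... | no  _ = contradiction (subst (_≤ _) e (matches≤length x ε xs)) (<⇒≱ (n<1+n _))

bit-complement : ∀ s p x → p ≢ x → bit (match? s p x) + bit (match? (not s) p x) ≡ 1
bit-complement s p x p≢x with <-cmp p x
bit-complement true p x p≢x | tri< a _ c = cong₂ _+_ (bit-yes (p <? x) a) (bit-no (x <? p) c)
bit-complement false p x p≢x | tri< a _ c = cong₂ _+_ (bit-no (x <? p) c) (bit-yes (p <? x) a)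
... | tri≈ _ b _ = contradiction b p≢x
bit-complement true p x p≢x | tri> a _ c = cong₂ _+_ (bit-no (p <? x) a) (bit-yes (x <? p) c)
bit-complement false p x p≢x | tri> a _ c = cong₂ _+_ (bit-yes (x <? p) c) (bit-no (p <? x) a)

-- A step between distinct colours agrees with exactly one of a sign and its negation. This links
-- the lowest coefficient in `q` for `ε` with the highest one for the negated signs.
matches-complement : ∀ {k p} {ε : Vec Bool k} {xs} → Distinct p ε xs →
  matches p ε xs + matches p (Vec.map not ε) xs ≡ k
matches-complement []                                    = refl
matches-complement (_∷_ {p = p} {s} {x} {ε} {xs} p≢x d) = trans
  (interchange (bit (match? s p x)) _ _ _)
  (cong₂ _+_ (bit-complement s p x p≢x) (matches-complement d))

-- From colourings of the labeled path to words.

IsPathColouring : ∀ {k} → Vec Bool k → ℕ → Monomial → Colouring (suc k) → Set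
IsPathColouring ε j α c =
  Distinct (head c) ε (tail c) × HasMonomial α c × matches (head c) ε (tail c) ≡ j

along-tabulate⁺ : ∀ {R k} (g : Fin (suc k) → ℕ) (e : Fin k → Bool) →
  (∀ a → R (e a) (g (inject₁ a)) (g (suc a))) → Along R (g zero) (tabulate e) (tabulate (g ∘ suc))
along-tabulate⁺ {k = zero}  g e r = []
along-tabulate⁺ {k = suc k} g e r = r zero ∷ along-tabulate⁺ (g ∘ suc) (e ∘ suc) (r ∘ suc)

along-tabulate⁻ : ∀ {R k} (g : Fin (suc k) → ℕ) (e : Fin k → Bool) →
  Along R (g zero) (tabulate e) (tabulate (g ∘ suc)) → ∀ a → R (e a) (g (inject₁ a)) (g (suc a))
along-tabulate⁻ g e (r ∷ _)  zero    = r
along-tabulate⁻ g e (_ ∷ rs) (suc a) = along-tabulate⁻ (g ∘ suc) (e ∘ suc) rs a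

length-filter-tabulate : ∀ {A : Set} {P : A → Set} (P? : Decidable P) {k} (h : Fin k → A) →
  length (filter P? (List.tabulate h)) ≡ sum (λ a → bit (P? (h a)))
length-filter-tabulate P? {zero}  h = refl
length-filter-tabulate P? {suc k} h with does (P? (h zero))
... | true  = cong suc (length-filter-tabulate P? (h ∘ suc))
... | false = length-filter-tabulate P? (h ∘ suc)

matches-tabulate : ∀ {k} (g : Fin (suc k) → ℕ) (e : Fin k → Bool) →
  matches (g zero) (tabulate e) (tabulate (g ∘ suc)) ≡ sum (λ a → bit (match? (e a) (g (inject₁ a)) (g (suc a))))
matches-tabulate {zero}  g e = refl
matches-tabulate {suc k} g e = cong (bit (match? (e zero) (g zero) (g (suc zero))) +_)
  (matches-tabulate (g ∘ suc) (e ∘ suc))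

multiplicity-lookup : ∀ {n} k (c : Colouring n) → multiplicity k c ≡ sum (λ i → δ k (lookup c i))
multiplicity-lookup k []      = refl
multiplicity-lookup k (x ∷ c) = trans (multiplicity-∷ k x c) (cong (δ k x +_) (multiplicity-lookup k c))

-- `Asc` lists an edge with its smaller label first; the Boolean says whether the label rises along
-- the path.
orient : {A : Set} → Bool → A → A → A × A
orient true  x y = x , y
orient false x y = y , x

module _ {n} (f : Fin n → ℕ) (x y : Fin n) where

  orient-ascent⁺ : (x<?y : Dec (x Fin.< y)) → x ≢ y → Match (does x<?y) (f x) (f y) →
    let (i , j) = orient (does x<?y) x y in i Fin.< j × f i < f j
  orient-ascent⁺ (yes x<y) x≢y m = x<y , m
  orient-ascent⁺ (no  x≮y) x≢y m = ≤∧≢⇒< (≮⇒≥ x≮y) (λ e → x≢y (sym (Finₚ.toℕ-injective e))) , m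

  orient-ascent⁻ : x Fin.< y → f x < f y →
    Match (does (x Fin.<? y)) (f x) (f y) × (x , y) ≡ orient (does (x Fin.<? y)) x y
  orient-ascent⁻ x<y m rewrite dec-true (x Fin.<? y) x<y = m , refl

  orient-ascent⁻′ : y Fin.< x → f y < f x →
    Match (does (x Fin.<? y)) (f x) (f y) × (y , x) ≡ orient (does (x Fin.<? y)) x y
  orient-ascent⁻′ y<x m rewrite dec-false (x Fin.<? y) (<-asym y<x) = m , refl

successive : ∀ {k} {a b : Fin (suc k)} → toℕ b ≡ suc (toℕ a) → ∃[ i ] (a ≡ inject₁ i × b ≡ suc i)
successive {a = a} {suc i} e =
  i , Finₚ.toℕ-injective (trans (sym (suc-injective e)) (sym (Finₚ.toℕ-inject₁ i))) , refl

inject₁≢suc : ∀ {k} (i : Fin k) → inject₁ i ≢ suc i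
inject₁≢suc i e = 1+n≢n (sym (trans (sym (Finₚ.toℕ-inject₁ i)) (cong toℕ e)))

-- Two steps of the path cannot traverse one edge in opposite directions; this is the mixed case in
-- `edge-injective`.
successors-not-mutual : ∀ {k} {a b : Fin k} → inject₁ a ≡ suc b → suc a ≢ inject₁ b
successors-not-mutual {a = a} {b} p q = m≢1+n+m (toℕ b) {1} (begin
  toℕ b               ≡⟨ Finₚ.toℕ-inject₁ b ⟨
  toℕ (inject₁ b)     ≡⟨ cong toℕ q ⟨
  suc (toℕ a)         ≡⟨ cong suc (Finₚ.toℕ-inject₁ a) ⟨
  suc (toℕ (inject₁ a)) ≡⟨ cong (suc ∘ toℕ) p ⟩
  suc (suc (toℕ b))   ∎)
  where open ≡-Reasoning

module _ {k} (σ : Permutation′ (suc k)) where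

  private
    G = labeledPath σ
    start end : Fin k → Fin (suc k)
    start a = σ ⟨$⟩ʳ inject₁ a
    end   a = σ ⟨$⟩ʳ suc a

    σ-injective : ∀ {a b} → σ ⟨$⟩ʳ a ≡ σ ⟨$⟩ʳ b → a ≡ b
    σ-injective = Injection.injective (Inverse⇒Injection σ)

    along off : Colouring (suc k) → Fin (suc k) → ℕ
    along c a = lookup c (σ ⟨$⟩ʳ a)
    off   c x = lookup c (σ ⟨$⟩ˡ x)

    up : Fin k → Bool
    up a = does (start a Fin.<? end a)

  signs : Vec Bool k
  signs = tabulate up

  alongPath : Colouring (suc k) → Colouring (suc k)
  alongPath c = tabulate (along c)

  offPath : Colouring (suc k) → Colouring (suc k)
  offPath c = tabulate (off c)

  offPath-alongPath : ∀ c → offPath (alongPath c) ≡ c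
  offPath-alongPath c = trans
    (tabulate-cong {f = off (alongPath c)} {g = lookup c} λ x →
      trans (lookup∘tabulate (along c) (σ ⟨$⟩ˡ x)) (cong (lookup c) (inverseʳ σ {x})))
    (tabulate∘lookup c)

  alongPath-offPath : ∀ c → alongPath (offPath c) ≡ c
  alongPath-offPath c = trans
    (tabulate-cong {f = along (offPath c)} {g = lookup c} λ x →
      trans (lookup∘tabulate (off c) (σ ⟨$⟩ʳ x)) (cong (lookup c) (inverseˡ σ {x})))
    (tabulate∘lookup c)

  multiplicity-alongPath : ∀ i c → multiplicity i (alongPath c) ≡ multiplicity i c
  multiplicity-alongPath i c = begin
    multiplicity i (alongPath c)                    ≡⟨ multiplicity-lookup i (alongPath c) ⟩
    sum (λ a → δ i (lookup (alongPath c) a))        ≡⟨ sum-cong-≗ {suc k} (λ a → cong (δ i) (lookup∘tabulate (along c) a)) ⟩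
    sum (λ a → δ i (lookup c (σ ⟨$⟩ʳ a)))           ≡⟨ sum-permute (λ x → δ i (lookup c x)) σ ⟨
    sum (λ x → δ i (lookup c x))                    ≡⟨ multiplicity-lookup i c ⟨
    multiplicity i c                                ∎
    where open ≡-Reasoning

  proper⇒distinct : ∀ {c} → Proper G c → Distinct (head (alongPath c)) signs (tail (alongPath c))
  proper⇒distinct {c} proper = along-tabulate⁺ (along c) up λ a → proper (start a) (end a)
    (inject₁ a , suc a , cong suc (sym (Finₚ.toℕ-inject₁ a)) , inj₁ (refl , refl))

  distinct⇒proper : ∀ {c} → Distinct (head (alongPath c)) signs (tail (alongPath c)) → Proper G c
  distinct⇒proper {c} d i j (a , b , b≡1+a , e) with successive b≡1+a
  distinct⇒proper {c} d i j (a , b , b≡1+a , inj₁ (refl , refl)) | s , refl , refl = along-tabulate⁻ (along c) up d s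
  distinct⇒proper {c} d i j (a , b , b≡1+a , inj₂ (refl , refl)) | s , refl , refl = ≢-sym (along-tabulate⁻ (along c) up d s)

  -- Each step of the path gives one edge, and the step agrees with its sign exactly when that edge,
  -- listed with its smaller label first, is an ascent.
  asc-alongPath : ∀ c → asc G c ≡ matches (head (alongPath c)) signs (tail (alongPath c))
  asc-alongPath c = trans
    (enumeration-size-unique {P = IsAscent} id id pairs
      (enumeration-image edge edge-injective edge-ascent ascent-edge steps))
    (trans (length-filter-tabulate isMatch? id) (sym (matches-tabulate (along c) up)))
    where
    IsAscent : Fin (suc k) × Fin (suc k) → Set
    IsAscent (i , j) = PathEdge σ i j × i Fin.< j × lookup c i < lookup c j

    IsMatch : Fin k → Set
    IsMatch a = Match (up a) (lookup c (start a)) (lookup c (end a))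

    isMatch? : Decidable IsMatch
    isMatch? a = match? (up a) _ _

    pairs : Enumeration IsAscent (asc G c)
    pairs = enumeration-filter
      (λ (i , j) → edge? G i j ×-dec (i Fin.<? j) ×-dec (lookup c i <? lookup c j))
      (Unique.cartesianProduct⁺ (Unique.allFin⁺ _) (Unique.allFin⁺ _))
      (λ {(i , j)} _ → ∈-cartesianProduct⁺ (∈-allFin i) (∈-allFin j))

    steps : Enumeration IsMatch (length (filter isMatch? (allFin k)))
    steps = enumeration-filter isMatch? (Unique.allFin⁺ k) (λ {a} _ → ∈-allFin a)

    edge : Fin k → Fin (suc k) × Fin (suc k)
    edge a = orient (up a) (start a) (end a)

    edge-injective : ∀ {a b} → edge a ≡ edge b → a ≡ b
    edge-injective {a} {b} e with up a | up b
    ... | true  | true  = Finₚ.suc-injective (σ-injective (cong proj₂ e))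
    ... | false | false = Finₚ.suc-injective (σ-injective (cong proj₁ e))
    ... | true  | false = contradiction (σ-injective (cong proj₂ e)) (successors-not-mutual (σ-injective (cong proj₁ e)))
    ... | false | true  = contradiction (σ-injective (cong proj₁ e)) (successors-not-mutual (σ-injective (cong proj₂ e)))

    edge-joined : ∀ a s → let (i , j) = orient s (start a) (end a) in PathEdge σ i j
    edge-joined a true  = inject₁ a , suc a , cong suc (sym (Finₚ.toℕ-inject₁ a)) , inj₁ (refl , refl)
    edge-joined a false = inject₁ a , suc a , cong suc (sym (Finₚ.toℕ-inject₁ a)) , inj₂ (refl , refl)

    edge-ascent : ∀ {a} → IsMatch a → IsAscent (edge a)
    edge-ascent {a} m = edge-joined a (up a) ,
      orient-ascent⁺ (lookup c) (start a) (end a) (start a Fin.<? end a) (λ e → inject₁≢suc a (σ-injective e)) m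

    ascent-edge : ∀ {ij} → IsAscent ij → ∃[ a ] (IsMatch a × ij ≡ edge a)
    ascent-edge ((a , b , b≡1+a , e) , i<j , m) with successive b≡1+a
    ascent-edge ((a , b , b≡1+a , inj₁ (refl , refl)) , i<j , m) | s , refl , refl =
      s , orient-ascent⁻ (lookup c) (start s) (end s) i<j m
    ascent-edge ((a , b , b≡1+a , inj₂ (refl , refl)) , i<j , m) | s , refl , refl =
      s , orient-ascent⁻′ (lookup c) (start s) (end s) i<j m

  -- Reading along the path permutes the entries of a colouring, hence is a bijection preserving the
  -- monomial. From here on the labeling enters only through its signs.
  cqf-enumeration : ∀ j α → Enumeration (IsPathColouring signs j α) (CQF G j α)
  cqf-enumeration j α = enumeration-image alongPath
    (λ {c} {d} e → trans (sym (offPath-alongPath c)) (trans (cong offPath e) (offPath-alongPath d)))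
    (λ {c} → alongPath-sound {c}) (λ {d} q → offPath d , offPath-sound {d} q , sym (alongPath-offPath d))
    (enumeration-filter (λ c → proper? G c ×-dec hasMonomial? α c ×-dec (asc G c ≟ j))
      (colourings-unique (bound α) (suc k))
      (λ {c} (_ , h , _) → ∈-colourings (coloursBounded α c h)))
    where
    IsColouring : Colouring (suc k) → Set
    IsColouring c = Proper G c × HasMonomial α c × asc G c ≡ j

    alongPath-sound : ∀ {c} → IsColouring c → IsPathColouring signs j α (alongPath c)
    alongPath-sound {c} (p , h , a) = proper⇒distinct {c} p ,
      (λ i → trans (multiplicity-alongPath i c) (h i)) , trans (sym (asc-alongPath c)) a

    offPath-sound : ∀ {d} → IsPathColouring signs j α d → IsColouring (offPath d)
    offPath-sound {d} q with subst (IsPathColouring signs j α) (sym (alongPath-offPath d)) q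
    ... | p , h , a = distinct⇒proper {offPath d} p ,
      (λ i → trans (sym (multiplicity-alongPath i (offPath d))) (h i)) , trans (asc-alongPath (offPath d)) a

-- Reducing invariance under all permutations to adjacent transpositions.

∈⇒≤listSum : ∀ {x xs} → x ∈ xs → x ≤ listSum xs
∈⇒≤listSum (here refl)           = m≤m+n _ _
∈⇒≤listSum {xs = y ∷ _} (there p) = ≤-trans (∈⇒≤listSum p) (m≤n+m _ y)

permute : ℕ ↔ ℕ → Monomial → Monomial
permute π α = record
  { exponent = λ i → exponent α (to π i)
  -- An index with nonzero exponent is `from π` of a number below `bound α`, so it is at most the
  -- sum of all these values.
  ; bound    = suc (listSum (List.map (from π) (upTo (bound α))))
  ; finite   = λ i b≤i → finite α (to π i) (≮⇒≥ λ i<b → <⇒≱ b≤i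
      (∈⇒≤listSum (subst (_∈ List.map (from π) (upTo (bound α))) (strictlyInverseʳ π i)
        (∈-map⁺ (from π) (∈-upTo⁺ i<b)))))
  }

swap : ℕ → ℕ → ℕ
swap zero    zero          = 1
swap zero    (suc zero)    = 0
swap zero    (suc (suc x)) = suc (suc x)
swap (suc a) zero          = zero
swap (suc a) (suc x)       = suc (swap a x)

swap-involutive : ∀ a x → swap a (swap a x) ≡ x
swap-involutive zero    zero          = refl
swap-involutive zero    (suc zero)    = refl
swap-involutive zero    (suc (suc x)) = refl
swap-involutive (suc a) zero          = refl
swap-involutive (suc a) (suc x)       = cong suc (swap-involutive a x)

swap-suc : ∀ a → swap a (suc a) ≡ a
swap-suc zero    = refl
swap-suc (suc a) = cong suc (swap-suc a)

swap-below : ∀ {a x} → x < a → swap a x ≡ x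
swap-below {suc a} {zero}  _   = refl
swap-below {suc a} {suc x} x<a = cong suc (swap-below (s<s⁻¹ x<a))

transposition : ℕ → ℕ ↔ ℕ
transposition a = mk↔ₛ′ (swap a) (swap a) (swap-involutive a) (swap-involutive a)

module _ (f : PowerSeries)
         (f-cong : ∀ α β → exponent α ≗ exponent β → f α ≡ f β)
         (f-transposition : ∀ a α → f α ≡ f (permute (transposition a) α)) where

  private
    -- α can be rearranged, without changing f, so that π fixes all i < m.
    record FixedBelow (m : ℕ) (α β : Monomial) : Set where
      field
        π     : ℕ ↔ ℕ
        α′    : Monomial
        same  : f α ≡ f α′
        moved : ∀ i → exponent β i ≡ exponent α′ (to π i)
        fixed : ∀ {i} → i < m → to π i ≡ i

    open FixedBelow

    -- The value `d + m` taken at `m` is brought down to `m` by `d` adjacent transpositions, none of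
    -- which moves a number below `m`.
    lower : ∀ {m α β} d (F : FixedBelow m α β) → to (π F) m ≡ d + m → FixedBelow (suc m) α β
    lower {m} zero F e = record
      { π = π F ; α′ = α′ F ; same = same F ; moved = moved F
      ; fixed = λ i<1+m → [ fixed F , (λ { refl → e }) ]′ (m≤n⇒m<n∨m≡n (s≤s⁻¹ i<1+m)) }
    lower {m} (suc d) F e = lower d (record
      { π     = transposition a ↔-∘ π F
      ; α′    = permute (transposition a) (α′ F)
      ; same  = trans (same F) (f-transposition a (α′ F))
      ; moved = λ i → trans (moved F i) (cong (exponent (α′ F)) (sym (swap-involutive a _)))
      ; fixed = λ i<m → trans (cong (swap a) (fixed F i<m)) (swap-below (<-≤-trans i<m (m≤n+m m d)))
      }) (trans (cong (swap a) e) (swap-suc a))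
      where a = d + m

    injective : (π : ℕ ↔ ℕ) → ∀ {i j} → to π i ≡ to π j → i ≡ j
    injective π = Injection.injective (Inverse⇒Injection π)

    fixBelow : ∀ {α β} (π : ℕ ↔ ℕ) → (∀ i → exponent β i ≡ exponent α (to π i)) → ∀ m → FixedBelow m α β
    fixBelow {α} π moved zero = record
      { π = π ; α′ = α ; same = refl ; moved = moved ; fixed = λ () }
    fixBelow π₀ moved₀ (suc m) = lower (to (π F) m ∸ m) F (sym (m∸n+n≡m m≤πm))
      where
      F = fixBelow π₀ moved₀ m
      m≤πm : m ≤ to (π F) m
      -- A value below `m` is already taken at the index equal to it.
      m≤πm = ≮⇒≥ λ πm<m → <⇒≢ πm<m (injective (π F) (fixed F πm<m))

  -- Finitely many transpositions suffice: when `π` fixes everything below `bound β`, its inverse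
  -- sends the remaining indices among themselves, and there both monomials vanish.
  transpositions⇒permutationInvariant : PermutationInvariant f
  transpositions⇒permutationInvariant π₀ α β moved₀ = trans (same F) (f-cong (α′ F) β agree)
    where
    F = fixBelow {α} {β} π₀ moved₀ (bound β)

    agree : exponent (α′ F) ≗ exponent β
    agree i with i <? bound β
    ... | yes i<b = sym (trans (moved F i) (cong (exponent (α′ F)) (fixed F i<b)))
    ... | no  i≮b = begin
      exponent (α′ F) i                       ≡⟨ cong (exponent (α′ F)) (strictlyInverseˡ (π F) i) ⟨
      exponent (α′ F) (to (π F) (from (π F) i)) ≡⟨ moved F (from (π F) i) ⟨
      exponent β (from (π F) i)               ≡⟨ finite β _ (≮⇒≥ λ j<b → i≮b
        (subst (_< bound β) (trans (sym (fixed F j<b)) (strictlyInverseˡ (π F) i)) j<b)) ⟩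
      0                                       ≡⟨ finite β i (≮⇒≥ i≮b) ⟨
      exponent β i                            ∎
      where open ≡-Reasoning

-- Degrees of the monomials of colourings.

listSum-+ : ∀ (f g : ℕ → ℕ) xs → listSum (List.map (λ i → f i + g i) xs) ≡ listSum (List.map f xs) + listSum (List.map g xs)
listSum-+ f g []       = refl
listSum-+ f g (x ∷ xs) = trans (cong (f x + g x +_) (listSum-+ f g xs)) (interchange (f x) (g x) _ _)

listSum-0 : ∀ (f : ℕ → ℕ) xs → (∀ {i} → i ∈ xs → f i ≡ 0) → listSum (List.map f xs) ≡ 0
listSum-0 f []       z = refl
listSum-0 f (x ∷ xs) z = cong₂ _+_ (z (here refl)) (listSum-0 f xs (z ∘ there))

listSum-cong : ∀ {f g : ℕ → ℕ} → f ≗ g → ∀ xs → listSum (List.map f xs) ≡ listSum (List.map g xs)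
listSum-cong f≗g []       = refl
listSum-cong f≗g (x ∷ xs) = cong₂ _+_ (f≗g x) (listSum-cong f≗g xs)

listSum-δ : ∀ x {xs} → Unique xs → listSum (List.map (λ i → δ i x) xs) ≤ 1
listSum-δ x []                     = z≤n
listSum-δ x {y ∷ xs} (y∉xs ∷ u) with y ≟ x
... | yes refl rewrite bit-yes (x ≟ x) refl | listSum-0 (λ i → δ i x) xs (λ {i} i∈ → bit-no (i ≟ x) λ e → ListAll.lookup y∉xs i∈ (sym e)) = ≤-refl
... | no y≢x rewrite bit-no (y ≟ x) y≢x = listSum-δ x u

listSum-multiplicity : ∀ {n xs} (c : Colouring n) → Unique xs → listSum (List.map (λ i → multiplicity i c) xs) ≤ n
listSum-multiplicity {xs = xs} []      u = ≤-reflexive (listSum-0 _ xs (λ _ → refl))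
listSum-multiplicity {xs = xs} (x ∷ c) u = begin
  listSum (List.map (λ i → multiplicity i (x ∷ c)) xs)                    ≡⟨ listSum-cong (λ i → multiplicity-∷ i x c) xs ⟩
  listSum (List.map (λ i → δ i x + multiplicity i c) xs)                  ≡⟨ listSum-+ (λ i → δ i x) _ xs ⟩
  listSum (List.map (λ i → δ i x) xs) + listSum (List.map (λ i → multiplicity i c) xs) ≤⟨ +-mono-≤ (listSum-δ x u) (listSum-multiplicity c u) ⟩
  suc _ ∎
  where open ≤-Reasoning

degree≤ : ∀ {n α} {c : Colouring n} → HasMonomial α c → degree α ≤ n
degree≤ {α = α} {c} h = ≤-trans
  (≤-reflexive (listSum-cong (sym ∘ h) (upTo (bound α))))
  (listSum-multiplicity c (Unique.upTo⁺ (bound α)))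

-- Exchanging `a` and `a + 1` on runs, and symmetry for constant signs.

inPair : ℕ → ℕ → Bool
inPair zero    zero          = true
inPair zero    (suc zero)    = true
inPair zero    (suc (suc x)) = false
inPair (suc a) zero          = false
inPair (suc a) (suc x)       = inPair a x

inPair-swap : ∀ a x → inPair a (swap a x) ≡ inPair a x
inPair-swap zero    zero          = refl
inPair-swap zero    (suc zero)    = refl
inPair-swap zero    (suc (suc x)) = refl
inPair-swap (suc a) zero          = refl
inPair-swap (suc a) (suc x)       = inPair-swap a x

swap-outside : ∀ a {x} → inPair a x ≡ false → swap a x ≡ x
swap-outside zero    {suc (suc x)} _ = refl
swap-outside (suc a) {zero}        _ = refl
swap-outside (suc a) {suc x}       e = cong suc (swap-outside a e)

swap-inside : ∀ a {x y} → inPair a x ≡ true → inPair a y ≡ true → x ≢ y → y ≡ swap a x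
swap-inside zero    {zero}     {zero}     _ _ x≢y = contradiction refl x≢y
swap-inside zero    {zero}     {suc zero} _ _ x≢y = refl
swap-inside zero    {suc zero} {zero}     _ _ x≢y = refl
swap-inside zero    {suc zero} {suc zero} _ _ x≢y = contradiction refl x≢y
swap-inside (suc a) {suc x}    {suc y}    p q x≢y = cong suc (swap-inside a p q (x≢y ∘ cong suc))

-- Nothing lies strictly between `a` and `a + 1`, so a colour outside the pair compares in the same
-- way with both.
<-swap : ∀ a {p x} → inPair a p ≡ false → p < x → p < swap a x
<-swap zero    {suc (suc p)} {suc (suc x)} _ p<x = p<x
<-swap zero    {suc (suc p)} {suc zero}    _ (s≤s ())
<-swap (suc a) {zero}        {suc x}       _ p<x = z<s
<-swap (suc a) {suc p}       {suc x}       e p<x = s<s (<-swap a e (s<s⁻¹ p<x))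

swap-< : ∀ a {p x} → inPair a p ≡ false → x < p → swap a x < p
swap-< zero    {suc (suc p)} {zero}        _ x<p = s<s z<s
swap-< zero    {suc (suc p)} {suc zero}    _ x<p = z<s
swap-< zero    {suc (suc p)} {suc (suc x)} _ x<p = x<p
swap-< (suc a) {suc p}       {zero}        _ x<p = z<s
swap-< (suc a) {suc p}       {suc x}       e x<p = s<s (swap-< a e (s<s⁻¹ x<p))

δ-swap : ∀ a k x → δ k (swap a x) ≡ δ (swap a k) x
δ-swap a k x = bit-cong (k ≟ swap a x) (swap a k ≟ x)
  (λ e → trans (cong (swap a) e) (swap-involutive a x))
  (λ e → trans (sym (swap-involutive a k)) (cong (swap a) e))

ups : ∀ {k} → Vec Bool k
ups = Vec.replicate _ true

-- An alternating run of a and a + 1 has as many ascents as descents if its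
-- length is odd, and uses both colours equally often if its length is even.
module Exchange (a : ℕ) where

  exchange : Bool → ℕ → ℕ
  exchange b x = if b then swap a x else x

  -- Parity of the length of the initial run.
  odd : ∀ {n} → Vec ℕ n → Bool
  odd []       = false
  odd (x ∷ xs) = if inPair a x then not (odd xs) else false

  -- Here `xs` follows the current entry. A run opened by that entry has odd length exactly when the
  -- initial run of `xs` has even length, whence the negation.
  decide : ∀ {n} → Bool → Bool → Vec ℕ n → Bool
  decide inRun b xs = if inRun then b else not (odd xs)

  -- In a run, b records whether that run is exchanged.
  exchangeRuns : ∀ {n} → Bool → Bool → Vec ℕ n → Vec ℕ n
  exchangeRuns inRun b []       = []
  exchangeRuns inRun b (x ∷ xs) =
    exchange (decide inRun b xs) x ∷ exchangeRuns (inPair a x) (decide inRun b xs) xs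

  exchange-involutive : ∀ b x → exchange b (exchange b x) ≡ x
  exchange-involutive true  x = swap-involutive a x
  exchange-involutive false x = refl

  inPair-exchange : ∀ b x → inPair a (exchange b x) ≡ inPair a x
  inPair-exchange true  x = inPair-swap a x
  inPair-exchange false x = refl

  exchange-outside : ∀ b {x} → inPair a x ≡ false → exchange b x ≡ x
  exchange-outside true  e = swap-outside a e
  exchange-outside false e = refl

  odd-exchangeRuns : ∀ {n} r b (xs : Vec ℕ n) → odd (exchangeRuns r b xs) ≡ odd xs
  odd-exchangeRuns r b []       = refl
  odd-exchangeRuns r b (x ∷ xs) = cong₂ (λ p o → if p then not o else false)
    (inPair-exchange (decide r b xs) x) (odd-exchangeRuns (inPair a x) (decide r b xs) xs)

  -- Exchanging moves no entry into or out of the pair, so runs and parities persist and the second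
  -- pass takes the same decisions.
  exchangeRuns-involutive : ∀ {n} r b (xs : Vec ℕ n) → exchangeRuns r b (exchangeRuns r b xs) ≡ xs
  exchangeRuns-involutive r b []       = refl
  exchangeRuns-involutive r b (x ∷ xs)
    rewrite odd-exchangeRuns (inPair a x) (decide r b xs) xs
          | inPair-exchange (decide r b xs) x
    = cong₂ _∷_ (exchange-involutive (decide r b xs) x) (exchangeRuns-involutive (inPair a x) (decide r b xs) xs)

  -- Inside a run both entries undergo the same injective map. If `p` is outside the pair, it is
  -- fixed by either decision, so the decision for `x` may be applied to both.
  exchange-≢ : ∀ {n} b (xs : Vec ℕ n) {p x} → p ≢ x → exchange b p ≢ exchange (decide (inPair a p) b xs) x
  exchange-≢ b xs {p} {x} p≢x e with inPair a p in eq
  ... | true  = p≢x (trans (sym (exchange-involutive b p)) (trans (cong (exchange b) e) (exchange-involutive b x)))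
  ... | false = p≢x (begin
    p                           ≡⟨ exchange-outside o eq ⟨
    exchange o p                ≡⟨ cong (exchange o) (exchange-outside b eq) ⟨
    exchange o (exchange b p)   ≡⟨ cong (exchange o) e ⟩
    exchange o (exchange o x)   ≡⟨ exchange-involutive o x ⟩
    x                           ∎)
    where
    open ≡-Reasoning
    o = not (odd xs)

  distinct-exchangeRuns : ∀ {k p} {ε : Vec Bool k} {xs} b → Distinct p ε xs →
    Distinct (exchange b p) ε (exchangeRuns (inPair a p) b xs)
  distinct-exchangeRuns b []                        = []
  distinct-exchangeRuns {p = p} b (_∷_ {xs = xs} p≢x d) =
    exchange-≢ b xs p≢x ∷ distinct-exchangeRuns (decide (inPair a p) b xs) d

  bit-<-exchange : ∀ b {p} x → inPair a p ≡ false → bit (p <? exchange b x) ≡ bit (p <? x)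
  bit-<-exchange false x e = refl
  bit-<-exchange true {p} x e = bit-cong (p <? swap a x) (p <? x)
    (λ l → subst (p <_) (swap-involutive a x) (<-swap a e l)) (<-swap a e)

  bit-exchange-< : ∀ b {p} x → inPair a p ≡ false → bit (exchange b x <? p) ≡ bit (x <? p)
  bit-exchange-< false x e = refl
  bit-exchange-< true {p} x e = bit-cong (swap a x <? p) (x <? p)
    (λ l → subst (_< p) (swap-involutive a x) (swap-< a e l)) (swap-< a e)

  private
    ascents : ∀ {k} → ℕ → Vec ℕ k → ℕ
    ascents p xs = matches p ups xs

  mutual
    -- Steps into or out of a run are unaffected, because one end lies outside the pair, and kept
    -- runs do not change; only the inside of an exchanged run needs an argument.
    ascents-start : ∀ {k x} {ε : Vec Bool k} {xs} → Distinct x ε xs →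
      ascents (exchange (not (odd xs)) x) (exchangeRuns (inPair a x) (not (odd xs)) xs) ≡ ascents x xs
    ascents-start {x = x} {xs = xs} d with inPair a x in e
    ... | false rewrite exchange-outside (not (odd xs)) e = ascents-outside (not (odd xs)) e d
    ... | true with odd xs in o
    ...   | true  = ascents-kept d
    ...   | false = ascents-exchanged e o d

    ascents-outside : ∀ {k p} {ε : Vec Bool k} {xs} b → inPair a p ≡ false → Distinct p ε xs →
      ascents p (exchangeRuns false b xs) ≡ ascents p xs
    ascents-outside b e []                        = refl
    ascents-outside b e (_∷_ {x = x} {xs = xs} p≢x d) =
      cong₂ _+_ (bit-<-exchange (not (odd xs)) x e) (ascents-start d)

    ascents-kept : ∀ {k y} {ε : Vec Bool k} {xs} → Distinct y ε xs →
      ascents y (exchangeRuns true false xs) ≡ ascents y xs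
    ascents-kept []                               = refl
    ascents-kept {y = y} (_∷_ {x = x} y≢x d) with inPair a x in e
    ... | false = cong (bit (y <? x) +_) (ascents-outside false e d)
    ... | true  = cong (bit (y <? x) +_) (ascents-kept d)

    -- An even number of entries of the run follow `y`, so its steps are taken in twos: one ascent
    -- and one descent, whose order the exchange reverses.
    ascents-exchanged : ∀ {k y} {ε : Vec Bool k} {xs} → inPair a y ≡ true → odd xs ≡ false → Distinct y ε xs →
      ascents (swap a y) (exchangeRuns true true xs) ≡ ascents y xs
    ascents-exchanged i o [] = refl
    ascents-exchanged {y = y} i o (_∷_ {x = x} y≢x d) with inPair a x in e
    ascents-exchanged {y = y} i o (_∷_ {x = x} y≢x d) | false
      rewrite swap-outside a e = cong₂ _+_ (bit-exchange-< true y e) (ascents-outside true e d)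
    ascents-exchanged {y = y} i o (_∷_ {x = x} y≢x (_∷_ {x = z} x≢z d)) | true with inPair a z in e′
    ... | true
      rewrite swap-inside a e e′ x≢z | swap-inside a i e y≢x | swap-involutive a y
      = trans (x∙yz≈y∙xz (bit (swap a y <? y)) (bit (y <? swap a y)) _)
          (cong (λ t → bit (y <? swap a y) + (bit (swap a y <? y) + t))
            (ascents-exchanged i (trans (sym (not-involutive _)) o) d))

  module _ (k : ℕ) where
   mutual
    multiplicity-outside : ∀ {n p} {ε : Vec Bool n} {xs} b → Distinct p ε xs →
      multiplicity k (exchangeRuns false b xs) ≡ multiplicity (swap a k) xs
    multiplicity-outside b []      = refl
    multiplicity-outside b (_ ∷ d) = multiplicity-start d

    multiplicity-start : ∀ {n x} {ε : Vec Bool n} {xs} → Distinct x ε xs →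
      multiplicity k (exchange (not (odd xs)) x ∷ exchangeRuns (inPair a x) (not (odd xs)) xs)
        ≡ multiplicity (swap a k) (x ∷ xs)
    multiplicity-start {x = x} {xs = xs} d with inPair a x in e
    ... | false rewrite exchange-outside (not (odd xs)) e =
      ∷-cong (exchangeRuns false (not (odd xs)) xs) xs
        (trans (cong (δ k) (sym (swap-outside a e))) (δ-swap a k x)) (multiplicity-outside (not (odd xs)) d)
    ... | true with odd xs in o
    ...   | true  = multiplicity-kept e o d
    ...   | false = ∷-cong (exchangeRuns true true xs) xs (δ-swap a k x) (multiplicity-exchanged d)

    multiplicity-exchanged : ∀ {n y} {ε : Vec Bool n} {xs} → Distinct y ε xs →
      multiplicity k (exchangeRuns true true xs) ≡ multiplicity (swap a k) xs
    multiplicity-exchanged []                      = refl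
    multiplicity-exchanged (_∷_ {x = x} {xs = xs} y≢x d) with inPair a x
    ... | true  = ∷-cong (exchangeRuns true true xs) xs (δ-swap a k x) (multiplicity-exchanged d)
    ... | false = ∷-cong (exchangeRuns false true xs) xs (δ-swap a k x) (multiplicity-outside true d)

    -- A run of even length splits into consecutive pairs `y`, `swap a y`, each using both colours
    -- once; keeping it therefore affects the exponents as exchanging it would.
    multiplicity-kept : ∀ {n y} {ε : Vec Bool n} {xs} → inPair a y ≡ true → odd xs ≡ true → Distinct y ε xs →
      multiplicity k (y ∷ exchangeRuns true false xs) ≡ multiplicity (swap a k) (y ∷ xs)
    multiplicity-kept {y = y} i o (_∷_ {x = x} {xs = xs} y≢x d) with inPair a x in e
    ... | true rewrite swap-inside a i e y≢x = begin
      multiplicity k (y ∷ swap a y ∷ ys)      ≡⟨ two y (swap a y) ys k ⟩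
      δ k y + (δ k (swap a y) + multiplicity k ys)
        ≡⟨ cong₂ (λ u v → u + (v + multiplicity k ys))
             (trans (cong (δ k) (sym (swap-involutive a y))) (δ-swap a k (swap a y))) (δ-swap a k y) ⟩
      δ s (swap a y) + (δ s y + multiplicity k ys)
        ≡⟨ cong (λ t → δ s (swap a y) + (δ s y + t))
             (multiplicity-kept-even (trans (sym (not-involutive _)) (cong not o)) d) ⟩
      δ s (swap a y) + (δ s y + multiplicity s xs) ≡⟨ x∙yz≈y∙xz (δ s (swap a y)) (δ s y) _ ⟩
      δ s y + (δ s (swap a y) + multiplicity s xs) ≡⟨ two y (swap a y) xs s ⟨
      multiplicity s (y ∷ swap a y ∷ xs)      ∎
      where
      open ≡-Reasoning
      s = swap a k
      ys = exchangeRuns true false xs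
      two : ∀ {n} u v (c : Colouring n) l → multiplicity l (u ∷ v ∷ c) ≡ δ l u + (δ l v + multiplicity l c)
      two u v c l = trans (multiplicity-∷ l u (v ∷ c)) (cong (δ l u +_) (multiplicity-∷ l v c))

    multiplicity-kept-even : ∀ {n y} {ε : Vec Bool n} {xs} → odd xs ≡ false → Distinct y ε xs →
      multiplicity k (exchangeRuns true false xs) ≡ multiplicity (swap a k) xs
    multiplicity-kept-even o []                                  = refl
    multiplicity-kept-even o (_∷_ {x = x} {xs = xs} y≢x d) with inPair a x in e
    ... | true  = multiplicity-kept e (trans (sym (not-involutive _)) (cong not o)) d
    ... | false = ∷-cong (exchangeRuns false false xs) xs
      (trans (cong (δ k) (sym (swap-outside a e))) (δ-swap a k x)) (multiplicity-outside false d)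

    private
     ∷-cong : ∀ {n x y} (c d : Colouring n) → δ k x ≡ δ (swap a k) y →
       multiplicity k c ≡ multiplicity (swap a k) d → multiplicity k (x ∷ c) ≡ multiplicity (swap a k) (y ∷ d)
     ∷-cong {x = x} {y} c d p q = trans (multiplicity-∷ k x c)
       (trans (cong₂ _+_ p q) (sym (multiplicity-∷ (swap a k) y d)))

exchangeAll : ∀ {n} → ℕ → Colouring n → Colouring n
exchangeAll a = Exchange.exchangeRuns a false false

-- For descending signs the count is `k` minus the number of ascents, so the ascending case settles
-- both.
matches-exchangeAll : ∀ {k} a s (c : Colouring (suc k)) → Distinct (head c) (Vec.replicate k s) (tail c) →
  matches (head (exchangeAll a c)) (Vec.replicate k s) (tail (exchangeAll a c))
    ≡ matches (head c) (Vec.replicate k s) (tail c)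
matches-exchangeAll a true  (x ∷ xs) d = Exchange.ascents-start a d
matches-exchangeAll {k} a false c@(x ∷ xs) d = +-cancelʳ-≡ (matches x ups xs) _ _ (begin
  matches x′ downs xs′ + matches x ups xs   ≡⟨ cong (matches x′ downs xs′ +_) (Exchange.ascents-start a d) ⟨
  matches x′ downs xs′ + matches x′ ups xs′ ≡⟨ total x′ xs′ (Exchange.distinct-exchangeRuns a (not (Exchange.odd a xs)) d) ⟩
  k                                         ≡⟨ total x xs d ⟨
  matches x downs xs + matches x ups xs     ∎)
  where
  open ≡-Reasoning
  downs : Vec Bool k
  downs = Vec.replicate k false
  x′ = head (exchangeAll a c)
  xs′ = tail (exchangeAll a c)
  total : ∀ p ys → Distinct p downs ys → matches p downs ys + matches p ups ys ≡ k
  total p ys e = trans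
    (cong (λ ε → matches p downs ys + matches p ε ys) (sym (map-replicate not false k)))
    (matches-complement e)

exchangeAll-isPathColouring : ∀ {k} a s {j α} {c : Colouring (suc k)} →
  IsPathColouring (Vec.replicate k s) j α c →
  IsPathColouring (Vec.replicate k s) j (permute (transposition a) α) (exchangeAll a c)
exchangeAll-isPathColouring a s {c = c@(x ∷ xs)} (d , h , m) =
  Exchange.distinct-exchangeRuns a (not (Exchange.odd a xs)) d ,
  (λ i → trans (Exchange.multiplicity-start a i d) (h (swap a i))) ,
  trans (matches-exchangeAll a s c d) m

-- The exchange is injective and gives one inequality between the coefficients; applying it again
-- returns to the original exponents and gives the other.
constantSigns-symmetric : ∀ {k} s {j} {f : PowerSeries} →
  (∀ α → Enumeration (IsPathColouring (Vec.replicate k s) j α) (f α)) → IsSymmetricFunction f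
constantSigns-symmetric {k} s {j} {f} E =
  (suc k , λ α k<deg → enumeration-empty (λ { {c} (_ , h , _) → <⇒≱ k<deg (degree≤ {α = α} {c} h) }) (E α)) ,
  transpositions⇒permutationInvariant f f-cong f-transposition
  where
  f-cong : ∀ α β → exponent α ≗ exponent β → f α ≡ f β
  f-cong α β e = enumeration-size-unique
    (λ (d , h , m) → d , (λ i → trans (h i) (e i)) , m)
    (λ (d , h , m) → d , (λ i → trans (h i) (sym (e i))) , m) (E α) (E β)

  f-≤ : ∀ a α → f α ≤ f (permute (transposition a) α)
  f-≤ a α = enumeration-≤ (exchangeAll a) (λ {c} → exchangeAll-isPathColouring a s {α = α} {c})
    (λ {c} {d} _ _ e → trans (sym (Exchange.exchangeRuns-involutive a false false c))
      (trans (cong (exchangeAll a) e) (Exchange.exchangeRuns-involutive a false false d)))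
    (E α) (E (permute (transposition a) α))

  f-transposition : ∀ a α → f α ≡ f (permute (transposition a) α)
  f-transposition a α = ≤-antisym (f-≤ a α) (≤-trans (f-≤ a (permute (transposition a) α))
    (≤-reflexive (f-cong _ α (λ i → cong (exponent α) (swap-involutive a i)))))

-- Natural labelings are those with constant signs.

tabulate-constant : ∀ {k} {f : Fin k → Bool} {s} → (∀ a → f a ≡ s) → tabulate f ≡ Vec.replicate k s
tabulate-constant {zero}  e = refl
tabulate-constant {suc k} e = cong₂ _∷_ (e zero) (tabulate-constant (e ∘ suc))

inject₁-opposite-suc : ∀ {k} (a : Fin k) → ¬ (opposite (inject₁ a) Fin.< opposite (suc a))
inject₁-opposite-suc {k} a = ≤⇒≯ (subst₂ _≤_
  (sym (Finₚ.opposite-prop (suc a))) (sym (Finₚ.opposite-prop (inject₁ a)))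
  (∸-monoʳ-≤ k (subst (_≤ suc (toℕ a)) (sym (Finₚ.toℕ-inject₁ a)) (n≤1+n _))))

module _ {k} (σ : Permutation′ (suc k)) where

  natural⇒constantSigns : NaturalLabeling σ → ∃[ s ] signs σ ≡ Vec.replicate k s
  natural⇒constantSigns (inj₁ e) = true , tabulate-constant λ a →
    dec-true (_ Fin.<? _) (subst₂ Fin._<_ (sym (e (inject₁ a))) (sym (e (suc a)))
      (s≤s (≤-reflexive (Finₚ.toℕ-inject₁ a))))
  natural⇒constantSigns (inj₂ e) = false , tabulate-constant λ a →
    dec-false (_ Fin.<? _) (λ l → inject₁-opposite-suc a (subst₂ Fin._<_ (e (inject₁ a)) (e (suc a)) l))

increasing-growth : ∀ {k} (g : Fin (suc k) → ℕ) → (∀ a → g (inject₁ a) < g (suc a)) →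
  ∀ i → g zero + toℕ i ≤ g i
increasing-growth         g inc zero    = ≤-reflexive (+-identityʳ _)
increasing-growth {suc k} g inc (suc i) = begin
  g zero + suc (toℕ i)     ≡⟨ +-suc (g zero) (toℕ i) ⟩
  suc (g zero) + toℕ i     ≤⟨ +-monoˡ-≤ (toℕ i) (inc zero) ⟩
  g (suc zero) + toℕ i     ≤⟨ increasing-growth (g ∘ suc) (inc ∘ suc) i ⟩
  g (suc i)                ∎
  where open ≤-Reasoning

-- Strict growth over `k` steps uses up the whole range from `lo` to `lo + k`, so no value can
-- deviate.
increasing-tight : ∀ {k} (g : Fin (suc k) → ℕ) lo → (∀ a → g (inject₁ a) < g (suc a)) →
  lo ≤ g zero → (∀ i → g i ≤ lo + k) → ∀ i → g i ≡ lo + toℕ i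
increasing-tight {k} g lo inc low high zero = trans (≤-antisym
  (+-cancelʳ-≤ k (g zero) lo (≤-trans (≤-reflexive (cong (g zero +_) (sym (Finₚ.toℕ-fromℕ k))))
    (≤-trans (increasing-growth g inc (Fin.fromℕ k)) (high (Fin.fromℕ k))))) low) (sym (+-identityʳ lo))
increasing-tight {suc k} g lo inc low high (suc i) = trans
  (increasing-tight (g ∘ suc) (suc lo) (inc ∘ suc) (≤-<-trans low (inc zero))
    (λ a → ≤-trans (high (suc a)) (≤-reflexive (+-suc lo k))) i)
  (sym (+-suc lo (toℕ i)))

increasing⇒identity : ∀ {k} (f : Fin (suc k) → Fin (suc k)) → (∀ a → f (inject₁ a) Fin.< f (suc a)) → ∀ i → f i ≡ i
increasing⇒identity f inc i =
  Finₚ.toℕ-injective (increasing-tight (toℕ ∘ f) 0 inc z≤n (λ i → s≤s⁻¹ (Finₚ.toℕ<n (f i))) i)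

opposite-antitone : ∀ {n} {i j : Fin n} → i Fin.< j → opposite j Fin.< opposite i
opposite-antitone {n} {i} {j} i<j = subst₂ _<_ (sym (Finₚ.opposite-prop j)) (sym (Finₚ.opposite-prop i))
  (∸-monoʳ-< (s<s i<j) (Finₚ.toℕ<n j))

module _ {k} (σ : Permutation′ (suc k)) where

  private
    sign-at : ∀ {s} → signs σ ≡ Vec.replicate k s →
      ∀ a → does (σ ⟨$⟩ʳ inject₁ a Fin.<? σ ⟨$⟩ʳ suc a) ≡ s
    sign-at {s} e a = trans (sym (lookup∘tabulate _ a)) (trans (cong (λ v → lookup v a) e) (lookup-replicate a s))

    does-true : ∀ {A : Set} (a? : Dec A) → does a? ≡ true → A
    does-true (yes a) _ = a

    does-false : ∀ {A : Set} (a? : Dec A) → does a? ≡ false → ¬ A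
    does-false (no ¬a) _ = ¬a

  constantSigns⇒natural : ∀ s → signs σ ≡ Vec.replicate k s → NaturalLabeling σ
  constantSigns⇒natural true e = inj₁ (increasing⇒identity (σ ⟨$⟩ʳ_)
    λ a → does-true (σ ⟨$⟩ʳ inject₁ a Fin.<? σ ⟨$⟩ʳ suc a) (sign-at e a))
  -- Composing with `opposite` turns a decreasing labeling into an increasing one.
  constantSigns⇒natural false e = inj₂ λ i → trans (sym (Finₚ.opposite-involutive (σ ⟨$⟩ʳ i)))
    (cong opposite (increasing⇒identity (opposite ∘ (σ ⟨$⟩ʳ_)) (λ a → opposite-antitone (descending a)) i))
    where
    descending : ∀ a → σ ⟨$⟩ʳ suc a Fin.< σ ⟨$⟩ʳ inject₁ a
    descending a = ≤∧≢⇒< (≮⇒≥ (does-false (σ ⟨$⟩ʳ inject₁ a Fin.<? σ ⟨$⟩ʳ suc a) (sign-at e a)))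
      λ eq → inject₁≢suc a (sym (Injection.injective (Inverse⇒Injection σ) (Finₚ.toℕ-injective eq)))

  natural⇒symmetric : NaturalLabeling σ → SymmetricCQF (labeledPath σ)
  natural⇒symmetric nat j = constantSigns-symmetric s {j} {CQF (labeledPath σ) j}
    (λ α → subst (λ ε → Enumeration (IsPathColouring ε j α) (CQF (labeledPath σ) j α)) e (cqf-enumeration σ j α))
    where
    s = proj₁ (natural⇒constantSigns σ nat)
    e = proj₂ (natural⇒constantSigns σ nat)

-- Words fitting the signs, and rotations of the variables.

IsFit : ∀ {k} → Vec Bool k → Monomial → Colouring (suc k) → Set
IsFit ε α c = Fits (head c) ε (tail c) × HasMonomial α c

allBelow : ∀ {n} (c : Colouring n) {b} → Vec.sum c < b → VecAll.All (_< b) c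
allBelow []      _ = []
allBelow (x ∷ c) l = ≤-<-trans (m≤m+n x _) l ∷ allBelow c (≤-<-trans (m≤n+m _ x) l)

monomialOf : ∀ {n} → Colouring n → Monomial
monomialOf c = record
  { exponent = λ i → multiplicity i c
  ; bound    = suc (Vec.sum c)
  ; finite   = λ i b≤i → multiplicity-beyond (allBelow c ≤-refl) b≤i
  }

-- `rotateFrom j` raises the colours below `j` by one and sends `j` to 0, which is the effect of the
-- later `shift` on colours; `rotateTo j` is its inverse.
rotateTo rotateFrom : ℕ → ℕ → ℕ
rotateTo j zero    = j
rotateTo j (suc k) = if does (k <? j) then k else suc k
rotateFrom j x with <-cmp x j
... | tri< _ _ _ = suc x
... | tri≈ _ _ _ = 0
... | tri> _ _ _ = x

rotateFrom-< : ∀ {j x} → x < j → rotateFrom j x ≡ suc x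
rotateFrom-< {j} {x} x<j with <-cmp x j
... | tri< _ _ _   = refl
... | tri≈ x≮j _ _ = contradiction x<j x≮j
... | tri> x≮j _ _ = contradiction x<j x≮j

rotateFrom-≡ : ∀ j → rotateFrom j j ≡ 0
rotateFrom-≡ j with <-cmp j j
... | tri< _ j≢j _ = contradiction refl j≢j
... | tri≈ _ _ _   = refl
... | tri> _ j≢j _ = contradiction refl j≢j

rotateFrom-> : ∀ {j x} → j < x → rotateFrom j x ≡ x
rotateFrom-> {j} {x} j<x with <-cmp x j
... | tri< _ _ j≮x = contradiction j<x j≮x
... | tri≈ _ _ j≮x = contradiction j<x j≮x
... | tri> _ _ _   = refl

rotateTo-rotateFrom : ∀ j x → rotateTo j (rotateFrom j x) ≡ x
rotateTo-rotateFrom j x with <-cmp x j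
... | tri< x<j _ _ rewrite dec-true (x <? j) x<j = refl
... | tri≈ _ x≡j _ = sym x≡j
rotateTo-rotateFrom j (suc x) | tri> _ _ j<x rewrite dec-false (x <? j) (≤⇒≯ (s≤s⁻¹ j<x)) = refl

rotateFrom-rotateTo : ∀ j k → rotateFrom j (rotateTo j k) ≡ k
rotateFrom-rotateTo j zero = rotateFrom-≡ j
rotateFrom-rotateTo j (suc k) with k <? j
... | yes k<j rewrite dec-true (k <? j) k<j = rotateFrom-< k<j
... | no  k≮j rewrite dec-false (k <? j) k≮j = rotateFrom-> (s≤s (≮⇒≥ k≮j))

rotation : ℕ → ℕ ↔ ℕ
rotation j = mk↔ₛ′ (rotateTo j) (rotateFrom j) (rotateTo-rotateFrom j) (rotateFrom-rotateTo j)

δ-rotate : ∀ j k x → δ k (rotateFrom j x) ≡ δ (rotateTo j k) x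
δ-rotate j k x = bit-cong (k ≟ rotateFrom j x) (rotateTo j k ≟ x)
  (λ e → trans (cong (rotateTo j) e) (rotateTo-rotateFrom j x))
  (λ e → trans (sym (rotateFrom-rotateTo j k)) (cong (rotateFrom j) e))

multiplicity-keep : ∀ {n m} k x (c : Colouring n) → m ≤ multiplicity k c → m ≤ multiplicity k (x ∷ c)
multiplicity-keep k x c m≤ = ≤-trans m≤ (≤-trans (m≤n+m _ (δ k x)) (≤-reflexive (sym (multiplicity-∷ k x c))))

multiplicity-add : ∀ {n m} k (c : Colouring n) → m ≤ multiplicity k c → suc m ≤ multiplicity k (k ∷ c)
multiplicity-add k c m≤ = ≤-trans (s≤s m≤) (≤-reflexive (sym (multiplicity-here k c)))

-- Local minima, and the shapes of sign vectors that end with an up step.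

-- Sign vectors are read with a flag telling that the vertex reached so far is
-- not entered by an ascending step.
minima : ∀ {k} → Bool → Vec Bool k → ℕ
minima true  []          = 1
minima false []          = 0
minima true  (true ∷ ε)  = suc (minima false ε)
minima false (true ∷ ε)  = minima false ε
minima _     (false ∷ ε) = minima true ε

-- A vertex coloured 0 is neither the end of an ascending step nor the start of a descending one, so
-- it is a local minimum.
multiplicity-zero≤minima : ∀ {k p xs} d (ε : Vec Bool k) → (d ≡ false → 0 < p) → Fits p ε xs →
  multiplicity 0 (p ∷ xs) ≤ minima d ε
multiplicity-zero≤minima {p = zero}  true  []          pos []        = ≤-refl
multiplicity-zero≤minima {p = suc p} true  []          pos []        = z≤n
multiplicity-zero≤minima {p = zero}  false []          pos []        = contradiction (pos refl) λ ()
multiplicity-zero≤minima {p = suc p} false []          pos []        = z≤n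
multiplicity-zero≤minima {p = zero}  true  (true ∷ ε)  pos (p<x ∷ f) =
  s≤s (multiplicity-zero≤minima false ε (λ _ → ≤-<-trans z≤n p<x) f)
multiplicity-zero≤minima {p = suc p} true  (true ∷ ε)  pos (p<x ∷ f) =
  m≤n⇒m≤1+n (multiplicity-zero≤minima false ε (λ _ → ≤-<-trans z≤n p<x) f)
multiplicity-zero≤minima {p = zero}  false (true ∷ ε)  pos (p<x ∷ f) = contradiction (pos refl) λ ()
multiplicity-zero≤minima {p = suc p} false (true ∷ ε)  pos (p<x ∷ f) =
  multiplicity-zero≤minima false ε (λ _ → ≤-<-trans z≤n p<x) f
multiplicity-zero≤minima {p = suc p} true  (false ∷ ε) pos (x<p ∷ f) = multiplicity-zero≤minima true ε (λ ()) f
multiplicity-zero≤minima {p = suc p} false (false ∷ ε) pos (x<p ∷ f) = multiplicity-zero≤minima true ε (λ ()) f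

data EndsUp : ∀ {k} → Bool → Vec Bool k → Set where
  []  : EndsUp false []
  _∷_ : ∀ {k d} {ε : Vec Bool k} s → EndsUp (not s) ε → EndsUp d (s ∷ ε)

-- A marked down step that starts the path or follows another down step. `here` also records that
-- the remainder ends with an up step, which the count of peaks needs.
data DoubleDown : ∀ {k} → Bool → Vec Bool k → Set where
  here  : ∀ {k} {ε : Vec Bool k} → EndsUp true ε → DoubleDown true (false ∷ ε)
  there : ∀ {k d} {ε : Vec Bool k} s → DoubleDown (not s) ε → DoubleDown d (s ∷ ε)

data IsolatedDowns : ∀ {k} → Bool → Vec Bool k → Set where
  []   : IsolatedDowns false []
  up   : ∀ {k d} {ε : Vec Bool k} → IsolatedDowns false ε → IsolatedDowns d (true ∷ ε)
  down : ∀ {k} {ε : Vec Bool k} → IsolatedDowns true ε → IsolatedDowns false (false ∷ ε)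

classify : ∀ {k d} {ε : Vec Bool k} → EndsUp d ε → DoubleDown d ε ⊎ IsolatedDowns d ε
classify [] = inj₂ []
classify (true ∷ e) with classify e
... | inj₁ a = inj₁ (there true a)
... | inj₂ b = inj₂ (up b)
classify {d = true}  (false ∷ e) = inj₁ (here e)
classify {d = false} (false ∷ e) with classify e
... | inj₁ a = inj₁ (there false a)
... | inj₂ b = inj₂ (down b)

-- Sign vectors with a double descent.

module Overfull (N : ℕ) where

  -- Valleys get 0 and peaks N; the value at ([] , true) is never relevant.
  level : ∀ {k} → Bool → ℕ → Vec Bool k → ℕ
  level         true  i []          = 0
  level         true  i (true ∷ ε)  = 0
  level {suc k} true  i (false ∷ ε) = suc k
  level         false i []          = N
  level         false i (true ∷ ε)  = i
  level         false i (false ∷ ε) = N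

  level-true≤ : ∀ {k} i (ε : Vec Bool k) → level true i ε ≤ k
  level-true≤ i []          = z≤n
  level-true≤ i (true ∷ ε)  = z≤n
  level-true≤ i (false ∷ ε) = ≤-refl

  -- Ascending interior vertices carry their position and descending ones the number of steps left,
  -- so both sequences move in the right direction; the bound keeps them below the peaks.
  level-step : ∀ {k} d i s (ε : Vec Bool k) → i + suc k < N → Match s (level d i (s ∷ ε)) (level (not s) (suc i) ε)
  level-step {k} d i true ε l = ≤-<-trans (below d) (above ε)
    where
    i<N : i < N
    i<N = ≤-<-trans (m≤m+n i (suc k)) l
    below : ∀ d → level d i (true ∷ ε) ≤ i
    below true  = z≤n
    below false = ≤-refl
    above : ∀ {k} (ε : Vec Bool k) → i < level false (suc i) ε
    above []          = i<N
    above (true ∷ ε)  = ≤-refl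
    above (false ∷ ε) = i<N
  level-step {k} true  i false ε l = s≤s (level-true≤ (suc i) ε)
  level-step {k} false i false ε l = ≤-<-trans (level-true≤ (suc i) ε)
    (<-trans (n<1+n k) (≤-<-trans (m≤n+m (suc k) i) l))

  levels : ∀ {k} → ℕ → Vec Bool k → Vec ℕ k
  levels i []      = []
  levels i (s ∷ ε) = level (not s) (suc i) ε ∷ levels (suc i) ε

  levels-fit : ∀ {k} d i (ε : Vec Bool k) → i + k < N → Fits (level d i ε) ε (levels i ε)
  levels-fit d i []      l = []
  levels-fit {suc k} d i (s ∷ ε) l = level-step d i s ε l ∷ levels-fit (not s) (suc i) ε (subst (_< N) (+-suc i k) l)

  -- Colours before the chosen double descent are raised by N, so that N is the
  -- colour of the valleys before it, of the double descent, and of the peaks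
  -- after it.
  first : ∀ {k d} {ε : Vec Bool k} → ℕ → DoubleDown d ε → ℕ
  first                 i (here _)    = N
  first {d = d} {s ∷ ε} i (there _ a) = N + level d i (s ∷ ε)

  rest : ∀ {k d} {ε : Vec Bool k} → ℕ → DoubleDown d ε → Vec ℕ k
  rest {ε = ε} i (here _)    = levels i ε
  rest         i (there s a) = first (suc i) a ∷ rest (suc i) a

  overfull-fits : ∀ {k d} {ε : Vec Bool k} i (a : DoubleDown d ε) → i + k < N → Fits (first i a) ε (rest i a)
  overfull-fits {suc k} i (here {ε = ε} _) l =
    ≤-<-trans (level-true≤ (suc i) ε) (<-trans (n<1+n k) (≤-<-trans (m≤n+m (suc k) i) l)) ∷
    levels-fit true (suc i) ε (subst (_< N) (+-suc i k) l)
  overfull-fits {suc k} {d} {ε = _ ∷ ε} i (there s a) l =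
    step s a ∷ overfull-fits (suc i) a (subst (_< N) (+-suc i k) l)
    where
    step : ∀ s (a : DoubleDown (not s) ε) → Match s (N + level d i (s ∷ ε)) (first (suc i) a)
    step true  (there s′ a)  = +-monoʳ-< N (level-step d i true ε l)
    step false (there s′ a)  = +-monoʳ-< N (level-step d i false ε l)
    -- A vertex left by a down step has positive level, so its raised colour exceeds `N`.
    step false (here _)      = <-≤-trans (≤-reflexive (sym (+-comm N 1)))
      (+-monoʳ-≤ N (≤-<-trans z≤n (level-step d i false ε l)))

  -- The number of peaks ahead in a word ending with an up step: one for each valley ahead, and one
  -- more when an ascent is already under way.
  target : ∀ {k} → Bool → Vec Bool k → ℕ
  target true  ε = minima true ε
  target false ε = suc (minima false ε)

  multiplicity-levels : ∀ {k} d i (ε : Vec Bool k) → EndsUp d ε →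
    target d ε ≤ multiplicity N (level d i ε ∷ levels i ε)
  multiplicity-levels false i []          []          = ≤-reflexive (sym (multiplicity-here N []))
  multiplicity-levels true  i (true ∷ ε)  (true ∷ e)  =
    multiplicity-keep N 0 (levels i (true ∷ ε)) (multiplicity-levels false (suc i) ε e)
  multiplicity-levels true  i (false ∷ ε) (false ∷ e) =
    multiplicity-keep N _ (levels i (false ∷ ε)) (multiplicity-levels true (suc i) ε e)
  multiplicity-levels false i (true ∷ ε)  (true ∷ e)  =
    multiplicity-keep N i (levels i (true ∷ ε)) (multiplicity-levels false (suc i) ε e)
  multiplicity-levels false i (false ∷ ε) (false ∷ e) =
    multiplicity-add N (levels i (false ∷ ε)) (multiplicity-levels true (suc i) ε e)

  -- Every valley before the double descent has colour `N`, and every valley after it is matched by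
  -- a peak of that colour; the vertex of the double descent is the surplus.
  multiplicity-overfull : ∀ {k d} {ε : Vec Bool k} i (a : DoubleDown d ε) →
    minima d ε < multiplicity N (first i a ∷ rest i a)
  multiplicity-overfull i (here {ε = ε} e) =
    multiplicity-add N (levels i (false ∷ ε)) (multiplicity-levels true (suc i) ε e)
  multiplicity-overfull {d = true} i (there true a) rewrite +-identityʳ N =
    multiplicity-add N (rest i (there {d = true} true a)) (multiplicity-overfull (suc i) a)
  multiplicity-overfull {d = false} i (there true a) =
    multiplicity-keep N (N + i) (rest i (there {d = false} true a)) (multiplicity-overfull (suc i) a)
  multiplicity-overfull {suc k} {true} i (there false a) =
    multiplicity-keep N (N + suc k) (rest i (there {d = true} false a)) (multiplicity-overfull (suc i) a)
  multiplicity-overfull {d = false} i (there false a) =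
    multiplicity-keep N (N + N) (rest i (there {d = false} false a)) (multiplicity-overfull (suc i) a)

module _ {k} {ε : Vec Bool k} {f : PowerSeries} (E : ∀ α → Enumeration (IsFit ε α) (f α))
         (invariant : PermutationInvariant f) where

  -- The rotation carries the exponent of `N` to the colour 0. By invariance some fitting word would
  -- then use 0 more often than there are local minima.
  doubleDown-impossible : ¬ DoubleDown true ε
  doubleDown-impossible a = <⇒≱ (multiplicity-overfull 0 a) (≤-trans
    (≤-reflexive (sym (h 0)))
    (multiplicity-zero≤minima true ε (λ ()) fits))
    where
    open Overfull (suc k)
    c = first 0 a ∷ rest 0 a
    α = monomialOf c
    β = permute (rotation (suc k)) α
    witness : ∃[ c′ ] IsFit ε β c′
    witness = enumeration-witness {x = c} (E α)
      (subst (Enumeration (IsFit ε β)) (sym (invariant (rotation (suc k)) α β (λ _ → refl))) (E β))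
      (overfull-fits 0 a ≤-refl , λ _ → refl)
    x∷xs : ∃[ x ] ∃[ xs ] IsFit ε β (x ∷ xs)
    x∷xs with witness
    ... | x ∷ xs , p = x , xs , p
    fits = proj₁ (proj₂ (proj₂ x∷xs))
    h = proj₂ (proj₂ (proj₂ x∷xs))

-- Sign vectors whose down steps are isolated.

descents : ∀ {k} → Vec Bool k → ℕ
descents []          = 0
descents (true ∷ ε)  = descents ε
descents (false ∷ ε) = suc (descents ε)

module Shift (j : ℕ) where

  -- Every maximal ascending run contains the colour j.
  data Hits : ∀ {k} → ℕ → Vec Bool k → Vec ℕ k → Set where
    []   : ∀ {p} → j ≤ p → Hits p [] []
    up   : ∀ {k p x} {ε : Vec Bool k} {xs} → (p < j → x ≤ j) → Hits x ε xs → Hits p (true ∷ ε) (x ∷ xs)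
    down : ∀ {k p x} {ε : Vec Bool k} {xs} → j ≤ p → x ≤ j → Hits x ε xs → Hits p (false ∷ ε) (x ∷ xs)

  mutual
    -- Colours increase strictly along an ascending run, so `j` occurs at most once in each of the
    -- `suc (descents ε)` runs. The variants tell whether the run at `p` has already reached `j`.
    few-above : ∀ {k p} {ε : Vec Bool k} {xs} → j ≤ p → Fits p ε xs → multiplicity j xs ≤ descents ε
    few-above j≤p [] = z≤n
    few-above {ε = true ∷ _} {x ∷ xs} j≤p (p<x ∷ f) =
      ≤-trans (≤-reflexive (multiplicity-there xs (<⇒≢ (≤-<-trans j≤p p<x))))
        (few-above (<⇒≤ (≤-<-trans j≤p p<x)) f)
    few-above {ε = false ∷ _} j≤p (x<p ∷ f) = few f

    few-below : ∀ {k p} {ε : Vec Bool k} {xs} → p < j → Fits p ε xs → multiplicity j xs ≤ suc (descents ε)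
    few-below p<j [] = z≤n
    few-below {ε = true ∷ _} p<j (p<x ∷ f) = few f
    few-below {ε = false ∷ _} {x ∷ xs} p<j (x<p ∷ f) =
      ≤-trans (≤-reflexive (multiplicity-there xs (≢-sym (<⇒≢ (<-trans x<p p<j)))))
        (m≤n⇒m≤1+n (few-below (<-trans x<p p<j) f))

    few : ∀ {k x} {ε : Vec Bool k} {xs} → Fits x ε xs → multiplicity j (x ∷ xs) ≤ suc (descents ε)
    few {x = x} {xs = xs} f with <-cmp x j
    ... | tri< x<j x≢j _ = ≤-trans (≤-reflexive (multiplicity-there xs (≢-sym x≢j))) (few-below x<j f)
    ... | tri≈ _ refl _  = ≤-trans (≤-reflexive (multiplicity-here x xs)) (s≤s (few-above ≤-refl f))
    ... | tri> _ x≢j j<x = ≤-trans (≤-reflexive (multiplicity-there xs (≢-sym x≢j)))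
      (m≤n⇒m≤1+n (few-above (<⇒≤ j<x) f))

  mutual
    -- Equality in the bounds above leaves no run without `j`: a run starting above `j`, or ending
    -- below it, would make the count too small.
    hits-above : ∀ {k p} {ε : Vec Bool k} {xs} → j ≤ p → Fits p ε xs →
      descents ε ≤ multiplicity j xs → Hits p ε xs
    hits-above j≤p [] m = [] j≤p
    hits-above {ε = true ∷ _} {x ∷ xs} j≤p (p<x ∷ f) m = up (λ p<j → contradiction p<j (≤⇒≯ j≤p))
      (hits-above (<⇒≤ (≤-<-trans j≤p p<x)) f
        (≤-trans m (≤-reflexive (multiplicity-there xs (<⇒≢ (≤-<-trans j≤p p<x))))))
    hits-above {ε = false ∷ _} j≤p (x<p ∷ f) m = let (x≤j , h) = hits f m in down j≤p x≤j h

    hits-below : ∀ {k p} {ε : Vec Bool k} {xs} → p < j → Fits p ε xs →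
      suc (descents ε) ≤ multiplicity j xs → Hits p ε xs
    hits-below {ε = true ∷ _} p<j (p<x ∷ f) m = let (x≤j , h) = hits f m in up (λ _ → x≤j) h
    hits-below {ε = false ∷ _} {x ∷ xs} p<j (x<p ∷ f) m = contradiction
      (≤-trans m (≤-trans (≤-reflexive (multiplicity-there xs (≢-sym (<⇒≢ (<-trans x<p p<j)))))
        (few-below (<-trans x<p p<j) f))) 1+n≰n

    hits : ∀ {k x} {ε : Vec Bool k} {xs} → Fits x ε xs →
      suc (descents ε) ≤ multiplicity j (x ∷ xs) → x ≤ j × Hits x ε xs
    hits {x = x} {xs = xs} f m with <-cmp x j
    ... | tri< x<j x≢j _ = <⇒≤ x<j , hits-below x<j f
      (≤-trans m (≤-reflexive (multiplicity-there xs (≢-sym x≢j))))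
    ... | tri≈ _ refl _ = ≤-refl , hits-above ≤-refl f
      (s≤s⁻¹ (≤-trans m (≤-reflexive (multiplicity-here x xs))))
    ... | tri> _ x≢j j<x = contradiction
      (≤-trans m (≤-trans (≤-reflexive (multiplicity-there xs (≢-sym x≢j))) (few-above (<⇒≤ j<x) f))) 1+n≰n

  -- Up to `j`, a run moves one place along to make room for its leading 0, so the vertex of `x`
  -- receives the raised colour of its predecessor `p`.
  place : ℕ → ℕ → ℕ
  place p x = if does (x ≤? j) then suc p else x

  place-≤ : ∀ p {x} → x ≤ j → place p x ≡ suc p
  place-≤ p {x} x≤j rewrite dec-true (x ≤? j) x≤j = refl

  place-> : ∀ p {x} → j < x → place p x ≡ x
  place-> p {x} j<x rewrite dec-false (x ≤? j) (<⇒≱ j<x) = refl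

  -- Together with a leading 0, this deletes the colour j from each ascending
  -- run, increases the colours below j by one, and starts the run with 0.
  shift : ∀ {k} → ℕ → Vec Bool k → Vec ℕ k → Vec ℕ k
  shift p []          []       = []
  shift p (true ∷ ε)  (x ∷ xs) = place p x ∷ shift x ε xs
  shift p (false ∷ ε) (x ∷ xs) = 0 ∷ shift x ε xs

  place-bounds : ∀ {p x} → p < x → p < place p x × place p x ≤ x
  place-bounds {p} {x} p<x with x ≤? j
  ... | yes x≤j rewrite place-≤ p x≤j = ≤-refl , p<x
  ... | no  x≰j rewrite place-> p (≰⇒> x≰j) = p<x , ≤-refl

  -- Here `h` is the new colour at the vertex of old colour `p`. New colours never exceed old ones,
  -- which keeps ascending steps ascending; a down step now arrives at 0 and, being isolated, leaves
  -- a vertex entered by an ascent, whose colour is positive.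
  shift-fits : ∀ {k d h p} {ε : Vec Bool k} {xs} → IsolatedDowns d ε → h ≤ p → (d ≡ false → 0 < h) →
    Fits p ε xs → Fits h ε (shift p ε xs)
  shift-fits []       h≤p pos []        = []
  shift-fits (up b)   h≤p pos (p<x ∷ f) =
    let (l , u) = place-bounds p<x
    in ≤-<-trans h≤p l ∷ shift-fits b u (λ _ → ≤-<-trans z≤n l) f
  shift-fits (down b) h≤p pos (x<p ∷ f) = pos refl ∷ shift-fits b z≤n (λ ()) f

  module _ (k : ℕ) where

    private
      k′ = rotateTo j k

    mutual
      multiplicity-shift-above : ∀ {n p} {ε : Vec Bool n} {xs} → j ≤ p → Fits p ε xs → Hits p ε xs →
        multiplicity k (shift p ε xs) ≡ multiplicity k′ xs
      multiplicity-shift-above j≤p []        ([] _) = refl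
      multiplicity-shift-above {p = p} {true ∷ ε} {x ∷ xs} j≤p (p<x ∷ f) (up _ h)
        rewrite place-> p (≤-<-trans j≤p p<x) = begin
        multiplicity k (x ∷ shift x ε xs)       ≡⟨ multiplicity-∷ k x (shift x ε xs) ⟩
        δ k x + multiplicity k (shift x ε xs)
          ≡⟨ cong₂ _+_ (trans (cong (δ k) (sym (rotateFrom-> j<x))) (δ-rotate j k x))
               (multiplicity-shift-above (<⇒≤ j<x) f h) ⟩
        δ k′ x + multiplicity k′ xs             ≡⟨ multiplicity-∷ k′ x xs ⟨
        multiplicity k′ (x ∷ xs)                ∎
        where
        open ≡-Reasoning
        j<x = ≤-<-trans j≤p p<x
      multiplicity-shift-above {ε = false ∷ ε} {x ∷ xs} j≤p (x<p ∷ f) (down _ x≤j h) =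
        trans (multiplicity-∷ k 0 (shift x ε xs))
          (trans (multiplicity-shift-below x≤j f h) (sym (multiplicity-∷ k′ x xs)))

      -- The 0 opening a run stands for its `j`, and `p` reappears one vertex later as `suc p`.
      -- Until `j` is reached that 0 must be carried along, hence the extra summand on each side.
      multiplicity-shift-below : ∀ {n p} {ε : Vec Bool n} {xs} → p ≤ j → Fits p ε xs → Hits p ε xs →
        δ k 0 + multiplicity k (shift p ε xs) ≡ δ k′ p + multiplicity k′ xs
      multiplicity-shift-below {p = p} p≤j f h with m≤n⇒m<n∨m≡n p≤j
      multiplicity-shift-below p≤j f h | inj₂ refl =
        cong₂ _+_ (trans (cong (δ k) (sym (rotateFrom-≡ j))) (δ-rotate j k j))
          (multiplicity-shift-above ≤-refl f h)
      multiplicity-shift-below p≤j f ([] j≤p) | inj₁ p<j = contradiction p<j (≤⇒≯ j≤p)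
      multiplicity-shift-below p≤j f (down j≤p _ _) | inj₁ p<j = contradiction p<j (≤⇒≯ j≤p)
      multiplicity-shift-below {p = p} {true ∷ ε} {x ∷ xs} p≤j (p<x ∷ f) (up hit h) | inj₁ p<j
        rewrite place-≤ p (hit p<j) = begin
        δ k 0 + multiplicity k (suc p ∷ shift x ε xs) ≡⟨ cong (δ k 0 +_) (multiplicity-∷ k (suc p) (shift x ε xs)) ⟩
        δ k 0 + (δ k (suc p) + multiplicity k (shift x ε xs)) ≡⟨ x∙yz≈y∙xz (δ k 0) (δ k (suc p)) _ ⟩
        δ k (suc p) + (δ k 0 + multiplicity k (shift x ε xs))
          ≡⟨ cong₂ _+_ (trans (cong (δ k) (sym (rotateFrom-< p<j))) (δ-rotate j k p))
               (multiplicity-shift-below (hit p<j) f h) ⟩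
        δ k′ p + (δ k′ x + multiplicity k′ xs)        ≡⟨ cong (δ k′ p +_) (multiplicity-∷ k′ x xs) ⟨
        δ k′ p + multiplicity k′ (x ∷ xs)             ∎
        where open ≡-Reasoning

  equal-above : ∀ {p q} → p ≡ q ⊎ (p ≤ j × q ≤ j) → j ≤ p → j ≤ q → p ≡ q
  equal-above (inj₁ p≡q)         _   _   = p≡q
  equal-above (inj₂ (p≤j , q≤j)) j≤p j≤q = trans (≤-antisym p≤j j≤p) (≤-antisym j≤q q≤j)

  place-mixed : ∀ {p q x y} → p < x → x ≤ j → j < y → place p x ≢ place q y
  place-mixed {p} {q} {x} {y} p<x x≤j j<y e = <⇒≱ j<y (begin
    y          ≡⟨ place-> q j<y ⟨
    place q y  ≡⟨ e ⟨
    place p x  ≡⟨ place-≤ p x≤j ⟩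
    suc p      ≤⟨ p<x ⟩
    x          ≤⟨ x≤j ⟩
    j          ∎)
    where open ≤-Reasoning

  -- Up to `j`, a colour `p` becomes visible only in the next entry `suc p`, so the hypothesis
  -- leaves it open. If the run ends or jumps above `j` instead, `Hits` forces `p` and `q` to be at
  -- least `j`, hence equal.
  shift-injective : ∀ {k p q} {ε : Vec Bool k} {xs ys} → p ≡ q ⊎ (p ≤ j × q ≤ j) →
    Fits p ε xs → Hits p ε xs → Fits q ε ys → Hits q ε ys → shift p ε xs ≡ shift q ε ys → p ≡ q × xs ≡ ys
  shift-injective r [] ([] j≤p) [] ([] j≤q) e = equal-above r j≤p j≤q , refl
  shift-injective {p = p} {q} {xs = x ∷ _} {y ∷ _} r (p<x ∷ f) (up hit h) (q<y ∷ f′) (up hit′ h′) e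
    with ∷-injective e | x ≤? j | y ≤? j
  ... | e₀ , e₁ | yes x≤j | yes y≤j = let (x≡y , xs≡ys) = shift-injective (inj₂ (x≤j , y≤j)) f h f′ h′ e₁ in
    suc-injective (trans (sym (place-≤ p x≤j)) (trans e₀ (place-≤ q y≤j))) , cong₂ _∷_ x≡y xs≡ys
  ... | e₀ , e₁ | yes x≤j | no y≰j = contradiction e₀ (place-mixed p<x x≤j (≰⇒> y≰j))
  ... | e₀ , e₁ | no x≰j | yes y≤j = contradiction (sym e₀) (place-mixed q<y y≤j (≰⇒> x≰j))
  ... | e₀ , e₁ | no x≰j | no y≰j =
    equal-above r (≮⇒≥ (x≰j ∘ hit)) (≮⇒≥ (y≰j ∘ hit′)) , cong₂ _∷_ x≡y (proj₂ (shift-injective (inj₁ x≡y) f h f′ h′ e₁))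
    where x≡y = trans (sym (place-> p (≰⇒> x≰j))) (trans e₀ (place-> q (≰⇒> y≰j)))
  shift-injective r (_ ∷ f) (down j≤p x≤j h) (_ ∷ f′) (down j≤q y≤j h′) e =
    let (x≡y , xs≡ys) = shift-injective (inj₂ (x≤j , y≤j)) f h f′ h′ (proj₂ (∷-injective e)) in
    equal-above r j≤p j≤q , cong₂ _∷_ x≡y xs≡ys

  -- 0, 1, …, j on the first ascending run, if it has j steps, and
  -- 0, j + 1, j + 2, … on the others.
  missed : ∀ {k} → ℕ → Vec Bool k → Vec ℕ k
  missed s []          = []
  missed s (true ∷ ε)  = s ∷ missed (suc s) ε
  missed s (false ∷ ε) = 0 ∷ missed (suc j) ε

  missed-fits : ∀ {k d h s} {ε : Vec Bool k} → IsolatedDowns d ε → h < s → (d ≡ false → 0 < h) →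
    Fits h ε (missed s ε)
  missed-fits []       h<s pos = []
  missed-fits (up b)   h<s pos = h<s ∷ missed-fits b (n<1+n _) (λ _ → ≤-<-trans z≤n h<s)
  missed-fits (down b) h<s pos = pos refl ∷ missed-fits b z<s (λ ())

  multiplicity-missed : ∀ {k} s (ε : Vec Bool k) → multiplicity 0 (missed (suc s) ε) ≡ descents ε
  multiplicity-missed s []          = refl
  multiplicity-missed s (true ∷ ε)  = multiplicity-missed (suc s) ε
  multiplicity-missed s (false ∷ ε) = cong suc (multiplicity-missed j ε)

data FirstDown : ∀ {k} → ℕ → Vec Bool k → Set where
  here  : ∀ {k} {ε : Vec Bool k} → FirstDown 0 (false ∷ ε)
  there : ∀ {k t} {ε : Vec Bool k} → FirstDown t ε → FirstDown (suc t) (true ∷ ε)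

firstDown : ∀ {k} (ε : Vec Bool k) → ε ≢ Vec.replicate k true → ∃[ t ] FirstDown t ε
firstDown []          ≢ups = contradiction refl ≢ups
firstDown (true ∷ ε)  ≢ups = let (t , d) = firstDown ε (≢ups ∘ cong (true ∷_)) in suc t , there d
firstDown (false ∷ ε) ≢ups = 0 , here

module _ {j : ℕ} where
  open Shift j

  -- A preimage would have the colour j both at the top of the first run and
  -- at the bottom of the second one.
  shift≢missed : ∀ {k d t s p} {ε : Vec Bool k} {xs} → FirstDown t ε → IsolatedDowns d ε → s + t ≡ suc j → p ≤ j →
    Fits p ε xs → Hits p ε xs → shift p ε xs ≢ missed s ε
  shift≢missed here (down (up b)) s+0 p≤j (y<p ∷ y<z ∷ f) (down _ _ (up {p = y} {x = z} hit h)) e with z ≤? j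
  -- The entry `suc y` would have to be `suc j`, although `y < z ≤ j`.
  ... | yes z≤j = <⇒≢ (<-≤-trans y<z z≤j)
    (suc-injective (trans (sym (place-≤ y z≤j)) (proj₁ (∷-injective (proj₂ (∷-injective e))))))
  ... | no  z≰j = z≰j (hit (<-≤-trans y<p p≤j))
  shift≢missed {s = s} {p} (there {t = t} l) (up b) s+t p≤j (p<x ∷ f) (up {x = x} hit h) e with x ≤? j
  ... | yes x≤j = shift≢missed l b (trans (sym (+-suc s t)) s+t) x≤j f h (proj₂ (∷-injective e))
  ... | no  x≰j = x≰j (subst (_≤ j) (trans (sym (proj₁ (∷-injective e))) (place-> p (≰⇒> x≰j)))
    (s≤s⁻¹ (subst (suc s ≤_) (trans (sym (+-suc s t)) s+t) (m≤m+n (suc s) t))))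

module _ {k} {ε : Vec Bool k} {f : PowerSeries} (E : ∀ α → Enumeration (IsFit ε α) (f α))
         (invariant : PermutationInvariant f) where

  -- Shifting injects the fitting words of `α` into those of `β` but misses `w`, so the two
  -- coefficients differ, although the monomials differ by a rotation only.
  isolatedDowns-impossible : ε ≢ Vec.replicate k true → ¬ IsolatedDowns true ε
  isolatedDowns-impossible ≢ups b = <-irrefl (invariant (rotation j) α β rotated)
    (enumeration-< image (λ {c} → into {c}) (λ {c} {d} → injective {c} {d}) (E α) (E β) {w} (missed-fits b z<s (λ ()) , λ _ → refl)
      λ { {c@(x ∷ xs)} P@(F , _) e → let (x≤j , h) = hit {c} P in
        shift≢missed (proj₂ (firstDown ε ≢ups)) b refl x≤j F h (proj₂ (∷-injective e)) })
    where
    -- The number of up steps before the first down step, so that `w` begins with exactly 0, 1, ...,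
    -- j on its first run.
    j = proj₁ (firstDown ε ≢ups)
    open Shift j

    w : Colouring (suc k)
    w = 0 ∷ missed 1 ε

    α β : Monomial
    β = monomialOf w
    -- The exponent of `α` at `j` is the number of zeros of `w`, one for each run, so every word of
    -- `α` has `j` in each run.
    α = permute (↔-sym (rotation j)) β

    rotated : ∀ i → exponent β i ≡ exponent α (rotateTo j i)
    rotated i = cong (exponent β) (sym (rotateFrom-rotateTo j i))

    image : Colouring (suc k) → Colouring (suc k)
    image c = 0 ∷ shift (head c) ε (tail c)

    hit : ∀ {c} → IsFit ε α c → head c ≤ j × Hits (head c) ε (tail c)
    hit {x ∷ xs} (F , h) = hits F (≤-reflexive (sym (begin
      multiplicity j (x ∷ xs)          ≡⟨ h j ⟩
      multiplicity (rotateFrom j j) w  ≡⟨ cong (λ i → multiplicity i w) (rotateFrom-≡ j) ⟩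
      suc (multiplicity 0 (missed 1 ε)) ≡⟨ cong suc (multiplicity-missed 0 ε) ⟩
      suc (descents ε)                 ∎)))
      where open ≡-Reasoning

    into : ∀ {c} → IsFit ε α c → IsFit ε β (image c)
    into {c@(x ∷ xs)} P@(F , h) = shift-fits b z≤n (λ ()) F , λ i → begin
      multiplicity i (0 ∷ shift x ε xs)          ≡⟨ multiplicity-∷ i 0 (shift x ε xs) ⟩
      δ i 0 + multiplicity i (shift x ε xs)      ≡⟨ multiplicity-shift-below i (proj₁ (hit {c} P)) F (proj₂ (hit {c} P)) ⟩
      δ (rotateTo j i) x + multiplicity (rotateTo j i) xs ≡⟨ multiplicity-∷ (rotateTo j i) x xs ⟨
      multiplicity (rotateTo j i) (x ∷ xs)       ≡⟨ h (rotateTo j i) ⟩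
      exponent α (rotateTo j i)                  ≡⟨ rotated i ⟨
      exponent β i                               ∎
      where open ≡-Reasoning

    injective : ∀ {c d} → IsFit ε α c → IsFit ε α d → image c ≡ image d → c ≡ d
    injective {c@(x ∷ xs)} {d@(y ∷ ys)} P Q e = let (x≤j , h) = hit {c} P ; (y≤j , h′) = hit {d} Q in
      let (x≡y , xs≡ys) = shift-injective (inj₂ (x≤j , y≤j)) (proj₁ P) h (proj₁ Q) h′ (proj₂ (∷-injective e)) in
      cong₂ _∷_ x≡y xs≡ys

  endsUp-impossible : ε ≢ Vec.replicate k true → ¬ EndsUp true ε
  endsUp-impossible ≢ups e with classify e
  ... | inj₁ a = doubleDown-impossible E invariant a
  ... | inj₂ b = isolatedDowns-impossible ≢ups b

-- The two extreme coefficients in `q`, and the equivalence.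

endsUp-or-complement : ∀ {k d d′} s (ε : Vec Bool k) → EndsUp d (s ∷ ε) ⊎ EndsUp d′ (Vec.map not (s ∷ ε))
endsUp-or-complement true  [] = inj₁ (true ∷ [])
endsUp-or-complement false [] = inj₂ (true ∷ [])
endsUp-or-complement s (s′ ∷ ε) with endsUp-or-complement s′ ε
... | inj₁ e = inj₁ (s ∷ e)
... | inj₂ e = inj₂ (not s ∷ e)

top⇒fit : ∀ {k} {ε : Vec Bool k} {f : PowerSeries} →
  (∀ α → Enumeration (IsPathColouring ε k α) (f α)) → ∀ α → Enumeration (IsFit ε α) (f α)
top⇒fit E α = enumeration-cong
  (λ (_ , h , m) → matches⇒fits _ _ _ m , h)
  (λ (F , h) → fits⇒distinct F , h , fits⇒matches F) (E α)

-- By `matches-complement`, no step agrees with `ε` exactly when all steps agree with its negation.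
bottom⇒fit : ∀ {k} {ε : Vec Bool k} {f : PowerSeries} →
  (∀ α → Enumeration (IsPathColouring ε 0 α) (f α)) → ∀ α → Enumeration (IsFit (Vec.map not ε) α) (f α)
bottom⇒fit {k} {ε} E α = enumeration-cong
  (λ {c} (d , h , m) →
    matches⇒fits _ _ _ (trans (cong (_+ matches (head c) (Vec.map not ε) (tail c)) (sym m)) (matches-complement d)) , h)
  (λ {c} (F , h) → let d = distinct-resp (fits⇒distinct F) in
    d , h , +-cancelʳ-≡ k (matches (head c) ε (tail c)) 0
      (trans (cong (matches (head c) ε (tail c) +_) (sym (fits⇒matches F))) (matches-complement d)))
  (E α)

-- For nonconstant signs, the highest coefficient gives a contradiction if the last sign is up, and
-- the lowest one, read with negated signs, if it is down.
invariant⇒constantSigns : ∀ {k} (ε : Vec Bool k) (F : ℕ → PowerSeries) →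
  (∀ j α → Enumeration (IsPathColouring ε j α) (F j α)) → (∀ j → PermutationInvariant (F j)) →
  ∃[ s ] ε ≡ Vec.replicate k s
invariant⇒constantSigns [] F E invariant = true , refl
invariant⇒constantSigns {suc k} ε@(s ∷ ε′) F E invariant
  with ≡-dec _≟ᵇ_ ε (Vec.replicate (suc k) true) | ≡-dec _≟ᵇ_ ε (Vec.replicate (suc k) false)
     | endsUp-or-complement {d = true} {true} s ε′
... | yes e   | _         | _      = true , e
... | no _    | yes e     | _      = false , e
... | no ≢ups | no _      | inj₁ e =
  contradiction e (endsUp-impossible (top⇒fit (E (suc k))) (invariant (suc k)) ≢ups)
... | no _    | no ≢downs | inj₂ e =
  contradiction e (endsUp-impossible (bottom⇒fit {ε = ε} (E 0)) (invariant 0) (≢downs ∘ complement))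
  where
  open ≡-Reasoning
  complement : Vec.map not ε ≡ Vec.replicate (suc k) true → ε ≡ Vec.replicate (suc k) false
  complement not≡ = begin
    ε                                        ≡⟨ map-id ε ⟨
    Vec.map id ε                             ≡⟨ map-cong not-involutive ε ⟨
    Vec.map (not ∘ not) ε                    ≡⟨ map-∘ not not ε ⟩
    Vec.map not (Vec.map not ε)              ≡⟨ cong (Vec.map not) not≡ ⟩
    Vec.map not (Vec.replicate (suc k) true) ≡⟨ map-replicate not true (suc k) ⟩
    Vec.replicate (suc k) false              ∎

symmetric⇒natural : ∀ {k} (σ : Permutation′ (suc k)) → SymmetricCQF (labeledPath σ) → NaturalLabeling σ
symmetric⇒natural σ symmetric = constantSigns⇒natural σ (proj₁ constant) (proj₂ constant)
  where
  constant = invariant⇒constantSigns (signs σ) (CQF (labeledPath σ)) (cqf-enumeration σ) (λ j → proj₂ (symmetric j))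

theorem1p1 : ∀ (n : ℕ) → n ≥ 1 → (σ : Permutation′ n) → SymmetricCQF (labeledPath σ) ⇔ NaturalLabeling σ
theorem1p1 (suc k) _ σ = mk⇔ (symmetric⇒natural σ) (natural⇒symmetric σ)
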